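{- Let $\Gamma$ be a finite graph which is a Cayley sum graph, or a twisted Cayley graph, or a twisted Cayley sum graph, or a vertex-transitive graph. Let $d$ denote the degree of $\Gamma$. Assume that $\Gamma$ is undirected and non-bipartite. Then $$\beta_{\mathrm{edge},\Gamma}\ \ge\ \frac{\mathfrak{h}_\Gamma}{90\,d}\qquad\text{and}\qquad \beta_{\mathrm{vert},\Gamma}\ \ge\ \frac{h_\Gamma}{135}.$$
   Context: Graphs may have loops (and multiple edges); a graph on a finite vertex set $V$ is encoded by its adjacency matrix $m:V\times V\to\mathbb{Z}_{\ge 0}$, undirected means $m$ is symmetric, and $d$-regular means $\sum_{u}m(v,u)=d$ for every $v$. For $A,B\subseteq V$ let $|E(A,B)|=\sum_{a\in A,b\in B}m(a,b)$. For $S\subseteq V$, $\mathcal N(S)$ is the set of vertices adjacent to some vertex of $S$, $\partial_{\mathrm{vert}}(S)=\mathcal N(S)\setminus S$, $\partial_{\mathrm{edge}}(S)=E(S,V\setminus S)$. Non-bipartite: there is no partition $V=V_1\sqcup V_2$ with $m(x,y)=0$ whenever $x,y$ lie in the same part. Let $G$ be a finite group, $S\subseteq G$, $\sigma$ an automorphism of $G$. The twisted Cayley graph $C(G,S)^\sigma$ has vertex set $G$, with $y$ adjacent to $x$ iff $y=\sigma(xs)$ for some $s\in S$; the twisted Cayley sum graph $C_\Sigma(G,S)^\sigma$ has $y$ adjacent to $x$ iff $y=\sigma(x^{ -1}s)$ for some $s\in S$. The Cayley graph $C(G,S)$ and Cayley sum graph $C_\Sigma(G,S)$ are the cases $\sigma=\mathrm{id}$.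 The degree is $d=|S|$. Edge Cheeger constant: $\mathfrak h_\Gamma=\min\{|\partial_{\mathrm{edge}}(S)|/(d|S|): \emptyset\ne S\subseteq V, |S|\le |V|/2\}$. Vertex Cheeger constant: $h_\Gamma=\min\{|\partial_{\mathrm{vert}}(S)|/|S|: \emptyset\ne S\subseteq V,|S|\le|V|/2\}$. For disjoint $L,R\subseteq V$ with $L\cup R\ne\emptyset$: $\beta_{\mathrm{edge}}(L,R)=\frac{|E(L,R^c)|+|E(R,L^c)|}{d|L\cup R|}$ and $\beta_{\mathrm{vert}}(L,R)=\frac{|L\cap\mathcal N(L)|+|R\cap\mathcal N(R)|+|\partial_{\mathrm{vert}}(L\cup R)|}{|L\cup R|}$; the edge (resp. vertex) bipartiteness constant $\beta_{\mathrm{edge},\Gamma}$ (resp. $\beta_{\mathrm{vert},\Gamma}$) is the minimum of $\beta_{\mathrm{edge}}(L,R)$ (resp. $\beta_{\mathrm{vert}}(L,R)$) over all such pairs. -}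

module Defs where

open import Data.Nat as ℕ using (ℕ; zero; suc; _+_; _*_)
open import Data.Bool using (Bool; true; false; if_then_else_; _∧_; _∨_)
open import Data.Fin using (Fin; zero; suc)
open import Data.Fin.Properties using (_≟_)
open import Data.Fin.Subset using (Subset; _∈_; _∩_; _∪_; ∁; ∣_∣; Nonempty)
open import Data.Vec using (lookup; tabulate)
open import Data.Integer using (+_)
open import Data.Rational using (ℚ; _/_) renaming (_*_ to _*ℚ_; _≤_ to _≤ℚ_)
open import Data.Product using (Σ; ∃; _×_; _,_)
open import Relation.Binary.PropositionalEquality using (_≡_)
open import Relation.Nullary using (¬_; does)
open import Function.Definitions using (Bijective)
open import Algebra.Structures using (IsGroup)

Σ[_] : (n : ℕ) → (Fin n → ℕ) → ℕ
Σ[ zero ] f = 0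
Σ[ suc n ] f = f zero + Σ[ n ] (λ i → f (suc i))

anyFin : (n : ℕ) → (Fin n → Bool) → Bool
anyFin zero p = false
anyFin (suc n) p = p zero ∨ anyFin n (λ i → p (suc i))

nonzero? : ℕ → Bool
nonzero? zero = false
nonzero? (suc _) = true

-- Graphs on the vertex set Fin n, given by adjacency matrices

Graph : ℕ → Set
Graph n = Fin n → Fin n → ℕ

module _ {n : ℕ} where

  Undirected : Graph n → Set
  Undirected m = ∀ x y → m x y ≡ m y x

  Regular : Graph n → ℕ → Set
  Regular m d = ∀ v → Σ[ n ] (λ u → m v u) ≡ d

  -- no partition V = V₁ ⊔ V₂ (given by a colouring P; parts may be empty)
  -- with m x y = 0 whenever x, y lie in the same part
  NonBipartite : Graph n → Set
  NonBipartite m = ¬ (Σ (Fin n → Bool) λ P → ∀ x y → P x ≡ P y → m x y ≡ 0)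

  E : Graph n → Subset n → Subset n → ℕ
  E m A B = Σ[ n ] λ a → Σ[ n ] λ b →
              if lookup A a ∧ lookup B b then m a b else 0

  𝒩 : Graph n → Subset n → Subset n
  𝒩 m S = tabulate λ u → anyFin n λ s → lookup S s ∧ nonzero? (m s u)

  ∂vert : Graph n → Subset n → Subset n
  ∂vert m S = 𝒩 m S ∩ ∁ S

  ∂edge : Graph n → Subset n → ℕ
  ∂edge m S = E m S (∁ S)

  CheegerSet : Subset n → Set
  CheegerSet S = Nonempty S × 2 * ∣ S ∣ ℕ.≤ n

  BipPair : Subset n → Subset n → Set
  BipPair L R = (∀ x → x ∈ L → x ∈ R → Data.Empty.⊥) × Nonempty (L ∪ R)
    where import Data.Empty

-- Rational numbers from naturals, and "q is the minimum of a family of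
-- ratios a/b" (all denominators b used below are positive).

ℕ→ℚ : ℕ → ℚ
ℕ→ℚ a = + a / 1

-- q ≤ a / b   (for b > 0), written multiplicatively
_≤[_/_] : ℚ → ℕ → ℕ → Set
q ≤[ a / b ] = q *ℚ ℕ→ℚ b ≤ℚ ℕ→ℚ a

-- q = a / b   (for b > 0), written multiplicatively
_≡[_/_] : ℚ → ℕ → ℕ → Set
q ≡[ a / b ] = q *ℚ ℕ→ℚ b ≡ ℕ→ℚ a

module _ {n : ℕ} (m : Graph n) (d : ℕ) where

  IsEdgeCheeger : ℚ → Set
  IsEdgeCheeger h =
    (Σ (Subset n) λ S → CheegerSet S × h ≡[ ∂edge m S / d * ∣ S ∣ ])
    × (∀ S → CheegerSet S → h ≤[ ∂edge m S / d * ∣ S ∣ ])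

  IsVertexCheeger : ℚ → Set
  IsVertexCheeger h =
    (Σ (Subset n) λ S → CheegerSet S × h ≡[ ∣ ∂vert m S ∣ / ∣ S ∣ ])
    × (∀ S → CheegerSet S → h ≤[ ∣ ∂vert m S ∣ / ∣ S ∣ ])

  βedgeNum : Subset n → Subset n → ℕ
  βedgeNum L R = E m L (∁ R) + E m R (∁ L)

  βvertNum : Subset n → Subset n → ℕ
  βvertNum L R = ∣ L ∩ 𝒩 m L ∣ + ∣ R ∩ 𝒩 m R ∣ + ∣ ∂vert m (L ∪ R) ∣

  IsEdgeBipartiteness : ℚ → Set
  IsEdgeBipartiteness β =
    (Σ (Subset n) λ L → Σ (Subset n) λ R →
       BipPair L R × β ≡[ βedgeNum L R / d * ∣ L ∪ R ∣ ])
    × (∀ L R → BipPair L R → β ≤[ βedgeNum L R / d * ∣ L ∪ R ∣ ])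

  IsVertexBipartiteness : ℚ → Set
  IsVertexBipartiteness β =
    (Σ (Subset n) λ L → Σ (Subset n) λ R →
       BipPair L R × β ≡[ βvertNum L R / ∣ L ∪ R ∣ ])
    × (∀ L R → BipPair L R → β ≤[ βvertNum L R / ∣ L ∪ R ∣ ])

record FinGroup (n : ℕ) : Set where
  field
    _∙_     : Fin n → Fin n → Fin n
    ε       : Fin n
    _⁻¹     : Fin n → Fin n
    isGroup : IsGroup _≡_ _∙_ ε _⁻¹

record Automorphism {n : ℕ} (G : FinGroup n) : Set where
  open FinGroup G
  field
    σ         : Fin n → Fin n
    bijective : Bijective _≡_ _≡_ σ
    hom       : ∀ x y → σ (x ∙ y) ≡ σ x ∙ σ y

identityAut : ∀ {n} (G : FinGroup n) → Automorphism G
identityAut G = record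
  { σ = λ x → x
  ; bijective = (λ eq → eq) , (λ y → y , λ eq → eq)
  ; hom = λ x y → Relation.Binary.PropositionalEquality.refl }

module _ {n : ℕ} (G : FinGroup n) (S : Subset n) (α : Automorphism G) where
  open FinGroup G
  open Automorphism α

  twistedCayley : Graph n
  twistedCayley x y =
    Σ[ n ] λ s → if lookup S s ∧ does (y ≟ σ (x ∙ s)) then 1 else 0

  twistedCayleySum : Graph n
  twistedCayleySum x y =
    Σ[ n ] λ s → if lookup S s ∧ does (y ≟ σ ((x ⁻¹) ∙ s)) then 1 else 0

module _ {n : ℕ} where

  IsCayleySumGraph : Graph n → Set
  IsCayleySumGraph m = Σ (FinGroup n) λ G → Σ (Subset n) λ S →
    ∀ x y → m x y ≡ twistedCayleySum G S (identityAut G) x y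

  IsTwistedCayleyGraph : Graph n → Set
  IsTwistedCayleyGraph m = Σ (FinGroup n) λ G → Σ (Subset n) λ S →
    Σ (Automorphism G) λ α → ∀ x y → m x y ≡ twistedCayley G S α x y

  IsTwistedCayleySumGraph : Graph n → Set
  IsTwistedCayleySumGraph m = Σ (FinGroup n) λ G → Σ (Subset n) λ S →
    Σ (Automorphism G) λ α → ∀ x y → m x y ≡ twistedCayleySum G S α x y

  IsVertexTransitive : Graph n → Set
  IsVertexTransitive m = ∀ u v → Σ (Fin n → Fin n) λ f →
    Bijective _≡_ _≡_ f × (∀ a b → m (f a) (f b) ≡ m a b) × f u ≡ v

{-# OPTIONS --safe #-}

-- In each of the four families, the pairs of permutations (φ , ψ) with
-- m (φ x) (ψ y) = m x y act transitively on the vertices. View a pair (L , R)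
-- of small bipartiteness ratio as a partial 2-colouring χ. Each two-fold
-- automorphism (φ , ψ) sorts the vertices into four classes, according to how
-- χ, χ ∘ φ and χ ∘ ψ compare; only edges that are bad for χ or for one of its
-- two translates run between different classes. If some union of classes has
-- size between n/30 and n/2, it is a sparse cut. Otherwise one class is almost
-- everything, and, as L and R are balanced, this means that φ and ψ almost
-- preserve χ up to a common sign. This sign is multiplicative, so letting the
-- group vote on the colour of each vertex (with vote sign(φ) χ(φ x)) is
-- equivariant: since the vote is decisive at one vertex, it is decisive
-- everywhere. The ends of an edge get opposite colours, as a random translate
-- of the edge is rarely bad, so the graph is bipartite.

module Submission where

open import Defs
open import Data.Nat using (ℕ; zero; suc; _+_; _*_; _^_; _≤_; _<_; z≤n; s≤s; _≤?_; _<?_; >-nonZero)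
open import Data.Nat.Properties using () renaming (_≟_ to _≟ℕ_)
open import Data.Nat.Properties hiding (_≟_)
open import Data.Nat.Tactic.RingSolver using (solve-∀)
import Data.Nat.Coprimality as Coprimality
import Data.Integer as ℤ
import Data.Integer.Properties as ℤₚ
open import Data.Rational using (ℚ; mkℚ; _/_) renaming (_*_ to _*ℚ_)
import Data.Rational as ℚ
import Data.Rational.Properties as ℚₚ
open import Data.Bool using (Bool; true; false; if_then_else_; _∧_; _∨_; not)
open import Data.Bool.Properties using (∧-conicalˡ; ∧-conicalʳ) renaming (_≟_ to _≟ᵇ_)
open import Data.Maybe using (Maybe; just; nothing; maybe; is-nothing)
open import Data.Maybe.Properties using (just-injective)
open import Data.Fin using (Fin; zero; suc; combine; punchOut; finToFun; funToFin)
open import Data.Fin.Properties using (_≟_; any?; all?; punchOut-injective; injective⇒≤; finToFun-funToFin; funToFin-finToFin)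
open import Data.Fin.Permutation using (permutation)
open import Data.Fin.Subset using (Subset; _∪_; _∩_; ∁; ∣_∣; Nonempty)
open import Data.Vec using (lookup; tabulate; _∷_; [])
open import Data.Vec.Properties using (lookup∘tabulate; lookup-map; lookup-zipWith; []=⇒lookup; lookup⇒[]=)
open import Data.Product using (∃; ∃₂; _×_; _,_; proj₁; proj₂)
open import Data.Sum using (_⊎_; inj₁; inj₂)
open import Data.Empty using (⊥; ⊥-elim)
open import Function using (_∘_; id; mk⇔; Injective)
open import Relation.Nullary using (¬_; Dec; yes; no; does; contradiction)
open import Relation.Nullary.Decidable using (_×-dec_; _→-dec_; does-⇔; map′; dec-true; decidable-stable)
open import Relation.Binary.PropositionalEquality
open import Algebra.Bundles using (Group)
import Algebra.Properties.Group as GroupProperties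
open import Algebra.Properties.CommutativeMonoid.Sum +-0-commutativeMonoid using (sum; ∑-distrib-+; ∑-comm; ∑-permute)
open import Algebra.Properties.Semiring.Sum +-*-semiring using (*-distribˡ-sum)

-- Why pairs: in a Cayley sum graph the map x ↦ x g need not preserve adjacency, but (x g)⁻¹ s = g⁻¹
-- (x⁻¹ s), so it does when the other end of each edge is moved by y ↦ g⁻¹ y instead. A twist σ is
-- absorbed in the same way. The price is that the two ends of an edge are moved by different maps,
-- so a sign is of use only if φ and ψ share it; hence the classes compare three colours at once.
-- Why the edge bound loses a factor d: transitivity makes φ x and ψ y uniform on the vertices
-- separately, but the pair (φ x , ψ y) need not be uniform on the edges. Bad edges must therefore
-- be charged to vertices and be few compared with n, not merely with d n. The numerator of the
-- vertex ratio counts vertices from the start.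

-- A linear inequality follows from a single one, once an identity shows
-- that the difference of the two sides only grows.
lin : ∀ {l r a b} s → l ≤ r → a + r + s ≡ b + l → a ≤ b
lin {l} {r} {a} {b} s l≤r eq = +-cancelʳ-≤ l a b (begin
  a + l     ≤⟨ +-monoʳ-≤ a l≤r ⟩
  a + r     ≤⟨ m≤m+n (a + r) s ⟩
  a + r + s ≡⟨ eq ⟩
  b + l     ∎)
  where open ≤-Reasoning

-- Finite sums and counting

𝟙 : Bool → ℕ
𝟙 true  = 1
𝟙 false = 0

Σ≡sum : ∀ {n} (f : Fin n → ℕ) → Σ[ n ] f ≡ sum f
Σ≡sum {zero}  f = refl
Σ≡sum {suc n} f = cong (f zero +_) (Σ≡sum (f ∘ suc))

Σ-cong : ∀ {n} {f g : Fin n → ℕ} → f ≗ g → Σ[ n ] f ≡ Σ[ n ] g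
Σ-cong {zero}  h = refl
Σ-cong {suc n} h = cong₂ _+_ (h zero) (Σ-cong (h ∘ suc))

Σ-mono : ∀ {n} {f g : Fin n → ℕ} → (∀ i → f i ≤ g i) → Σ[ n ] f ≤ Σ[ n ] g
Σ-mono {zero}  h = z≤n
Σ-mono {suc n} h = +-mono-≤ (h zero) (Σ-mono (h ∘ suc))

Σ-+ : ∀ {n} (f g : Fin n → ℕ) → Σ[ n ] (λ i → f i + g i) ≡ Σ[ n ] f + Σ[ n ] g
Σ-+ f g = trans (Σ≡sum (λ i → f i + g i)) (trans (∑-distrib-+ f g) (sym (cong₂ _+_ (Σ≡sum f) (Σ≡sum g))))

Σ-*ˡ : ∀ {n} k (f : Fin n → ℕ) → Σ[ n ] (λ i → k * f i) ≡ k * Σ[ n ] f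
Σ-*ˡ k f = trans (Σ≡sum (λ i → k * f i)) (trans (sym (*-distribˡ-sum k f)) (cong (k *_) (sym (Σ≡sum f))))

Σ-*ʳ : ∀ {n} k (f : Fin n → ℕ) → Σ[ n ] (λ i → f i * k) ≡ Σ[ n ] f * k
Σ-*ʳ k f = trans (Σ-cong λ i → *-comm (f i) k) (trans (Σ-*ˡ k f) (*-comm k _))

Σ-swap : ∀ {k n} (f : Fin k → Fin n → ℕ) →
  Σ[ k ] (λ i → Σ[ n ] (f i)) ≡ Σ[ n ] (λ j → Σ[ k ] (λ i → f i j))
Σ-swap f = begin
  _ ≡⟨ Σ-cong (λ i → Σ≡sum (f i)) ⟩
  _ ≡⟨ Σ≡sum (λ i → sum (f i)) ⟩
  _ ≡⟨ ∑-comm f ⟩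
  _ ≡⟨ Σ≡sum (λ j → sum (λ i → f i j)) ⟨
  _ ≡⟨ Σ-cong (λ j → Σ≡sum (λ i → f i j)) ⟨
  _ ∎
  where open ≡-Reasoning

Σ-const : ∀ n k → Σ[ n ] (λ _ → k) ≡ n * k
Σ-const zero    k = refl
Σ-const (suc n) k = cong (k +_) (Σ-const n k)

term≤Σ : ∀ {n} (f : Fin n → ℕ) i → f i ≤ Σ[ n ] f
term≤Σ f zero    = m≤m+n _ _
term≤Σ f (suc i) = ≤-trans (term≤Σ (f ∘ suc) i) (m≤n+m _ _)

Σ-< : ∀ {n} (f g : Fin n → ℕ) → Σ[ n ] f < Σ[ n ] g → ∃ λ i → f i < g i
Σ-< f g lt with any? (λ i → f i <? g i)
... | yes p = p
... | no ¬p = contradiction lt (≤⇒≯ (Σ-mono λ i → ≮⇒≥ λ lt′ → ¬p (i , lt′)))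

injective⇒surjective : ∀ {n} {f : Fin n → Fin n} → Injective _≡_ _≡_ f → ∀ y → ∃ λ x → f x ≡ y
injective⇒surjective {suc n} {f} inj y with any? (λ x → f x ≟ y)
... | yes p = p
... | no ¬p = contradiction (injective⇒≤ {f = g} g-inj) 1+n≰n
  where
  g : Fin (suc n) → Fin n
  g x = punchOut {i = y} (λ eq → ¬p (x , sym eq))
  g-inj : Injective _≡_ _≡_ g
  g-inj eq = inj (punchOut-injective {i = y} _ _ eq)

Σ-bijection : ∀ {k} (g : Fin k → ℕ) (f f⁻¹ : Fin k → Fin k) →
  (∀ y → f (f⁻¹ y) ≡ y) → (∀ x → f⁻¹ (f x) ≡ x) → Σ[ k ] (g ∘ f) ≡ Σ[ k ] g
Σ-bijection g f f⁻¹ r l = trans (Σ≡sum (g ∘ f)) (trans (sym (∑-permute g (permutation f f⁻¹ r l))) (sym (Σ≡sum g)))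

Σ-injection : ∀ {k} (g : Fin k → ℕ) {f : Fin k → Fin k} → Injective _≡_ _≡_ f → Σ[ k ] (g ∘ f) ≡ Σ[ k ] g
Σ-injection g {f} inj = Σ-bijection g f (proj₁ ∘ sur) (proj₂ ∘ sur) (λ x → inj (proj₂ (sur (f x))))
  where sur = injective⇒surjective inj

# : ∀ {n} → (Fin n → Bool) → ℕ
# p = Σ[ _ ] (𝟙 ∘ p)

-- Two-fold automorphisms

-- A two-fold automorphism: an automorphism of the bipartite double cover
-- of m that preserves both sides.
record TwoFold {n : ℕ} (m : Graph n) (φ ψ : Fin n → Fin n) : Set where
  constructor twoFold
  field
    injectiveˡ : Injective _≡_ _≡_ φ
    injectiveʳ : Injective _≡_ _≡_ ψ
    preserves  : ∀ x y → m (φ x) (ψ y) ≡ m x y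

open TwoFold

TwoFoldTransitive : ∀ {n} → Graph n → Set
TwoFoldTransitive m = ∀ u v → ∃₂ λ φ ψ → TwoFold m φ ψ × φ u ≡ v

module _ {n : ℕ} {m : Graph n} where

  twoFold-id : TwoFold m id id
  twoFold-id = twoFold id id (λ _ _ → refl)

  twoFold-∘ : ∀ {φ ψ φ′ ψ′} → TwoFold m φ ψ → TwoFold m φ′ ψ′ → TwoFold m (φ ∘ φ′) (ψ ∘ ψ′)
  twoFold-∘ t t′ = twoFold
    (injectiveˡ t′ ∘ injectiveˡ t)
    (injectiveʳ t′ ∘ injectiveʳ t)
    (λ x y → trans (preserves t _ _) (preserves t′ x y))

  -- Stands in for composing with an inverse: an injective self-map of a finite set is onto, so
  -- every vertex can be written as an image under φ′ or ψ′.
  twoFold-cancelʳ : ∀ {φ ψ φ′ ψ′} → TwoFold m φ′ ψ′ → TwoFold m (φ ∘ φ′) (ψ ∘ ψ′) → TwoFold m φ ψ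
  twoFold-cancelʳ {φ} {ψ} {φ′} {ψ′} t′ t = twoFold
    (cancel φ (injectiveˡ t′) (injectiveˡ t))
    (cancel ψ (injectiveʳ t′) (injectiveʳ t))
    pres
    where
    cancel : ∀ f {g} → Injective _≡_ _≡_ g → Injective _≡_ _≡_ (f ∘ g) → Injective _≡_ _≡_ f
    cancel f {g} inj inj′ {x} {y} eq with injective⇒surjective inj x | injective⇒surjective inj y
    ... | a , refl | b , refl = cong g (inj′ eq)
    pres : ∀ x y → m (φ x) (ψ y) ≡ m x y
    pres x y with injective⇒surjective (injectiveˡ t′) x | injective⇒surjective (injectiveʳ t′) y
    ... | a , refl | b , refl = trans (preserves t a b) (sym (preserves t′ a b))

  twoFold-cong : ∀ {φ ψ φ′ ψ′} → φ ≗ φ′ → ψ ≗ ψ′ → TwoFold m φ ψ → TwoFold m φ′ ψ′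
  twoFold-cong e e′ t = twoFold
    (λ eq → injectiveˡ t (trans (e _) (trans eq (sym (e _)))))
    (λ eq → injectiveʳ t (trans (e′ _) (trans eq (sym (e′ _)))))
    (λ x y → trans (sym (cong₂ m (e x) (e′ y))) (preserves t x y))

  twoFold-flip : Undirected m → ∀ {φ ψ} → TwoFold m φ ψ → TwoFold m ψ φ
  twoFold-flip und t = twoFold (injectiveʳ t) (injectiveˡ t)
    (λ x y → trans (und _ _) (trans (preserves t y x) (und y x)))

injective? : ∀ {n} (f : Fin n → Fin n) → Dec (Injective _≡_ _≡_ f)
injective? f = map′ (λ h {x} {y} → h x y) (λ inj x y → inj {x} {y})
  (all? λ x → all? λ y → (f x ≟ f y) →-dec (x ≟ y))

twoFold? : ∀ {n} (m : Graph n) φ ψ → Dec (TwoFold m φ ψ)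
twoFold? m φ ψ = map′ to (λ t → injectiveˡ t , injectiveʳ t , preserves t)
  (injective? φ ×-dec injective? ψ ×-dec all? λ x → all? λ y → m (φ x) (ψ y) ≟ℕ m x y)
  where
  to : Injective _≡_ _≡_ φ × Injective _≡_ _≡_ ψ × (∀ x y → m (φ x) (ψ y) ≡ m x y) → TwoFold m φ ψ
  to (a , b , c) = twoFold a b c

-- Averages over the group of two-fold automorphisms

𝟙-*-mono : ∀ {P : Set} (P? : Dec P) {a b} → (P → a ≤ b) → 𝟙 (does P?) * a ≤ 𝟙 (does P?) * b
𝟙-*-mono (yes p) h = *-monoʳ-≤ 1 (h p)
𝟙-*-mono (no _)  h = z≤n

SelfMap : ℕ → Set
SelfMap n = Fin n → Fin n

-- Maps are enumerated by codes, and decoding the code of a map returns it only up to pointwise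
-- equality; a summand must respect this equality before the sum can be reindexed.
Extensional : ∀ {n} → (SelfMap n → SelfMap n → ℕ) → Set
Extensional f = ∀ {φ φ′ ψ ψ′} → φ ≗ φ′ → ψ ≗ ψ′ → f φ ψ ≡ f φ′ ψ′

module Tally {n : ℕ} (m : Graph n) where

  private
    fun : Fin (n ^ n) → SelfMap n
    fun = finToFun {n} {n}

  abstract

    weight : SelfMap n → SelfMap n → ℕ
    weight φ ψ = 𝟙 (does (twoFold? m φ ψ))

    -- The sum of f over the (finite) group of two-fold automorphisms.
    tally : (SelfMap n → SelfMap n → ℕ) → ℕ
    tally f = Σ[ n ^ n ] λ i → Σ[ n ^ n ] λ j → weight (fun i) (fun j) * f (fun i) (fun j)

  order : ℕ
  order = tally λ _ _ → 1

  abstract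

    tally-mono : ∀ {f g} → (∀ {φ ψ} → TwoFold m φ ψ → f φ ψ ≤ g φ ψ) → tally f ≤ tally g
    tally-mono h = Σ-mono λ i → Σ-mono λ j → 𝟙-*-mono (twoFold? m (fun i) (fun j)) h

    tally-cong : ∀ {f g} → (∀ {φ ψ} → TwoFold m φ ψ → f φ ψ ≡ g φ ψ) → tally f ≡ tally g
    tally-cong h = ≤-antisym (tally-mono (≤-reflexive ∘ h)) (tally-mono (≤-reflexive ∘ sym ∘ h))

    tally-Σ : ∀ k (f : Fin k → SelfMap n → SelfMap n → ℕ) →
      tally (λ φ ψ → Σ[ k ] λ x → f x φ ψ) ≡ Σ[ k ] λ x → tally (f x)
    tally-Σ k f = begin
      tally (λ φ ψ → Σ[ k ] λ x → f x φ ψ)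
        ≡⟨ Σ-cong (λ i → Σ-cong λ j → sym (Σ-*ˡ (w i j) λ x → f x (fun i) (fun j))) ⟩
      Σ[ n ^ n ] (λ i → Σ[ n ^ n ] λ j → Σ[ k ] λ x → w i j * f x (fun i) (fun j))
        ≡⟨ Σ-cong (λ i → Σ-swap λ j x → w i j * f x (fun i) (fun j)) ⟩
      Σ[ n ^ n ] (λ i → Σ[ k ] λ x → Σ[ n ^ n ] λ j → w i j * f x (fun i) (fun j))
        ≡⟨ Σ-swap (λ i x → Σ[ n ^ n ] λ j → w i j * f x (fun i) (fun j)) ⟩
      Σ[ k ] (λ x → tally (f x)) ∎
      where
      open ≡-Reasoning
      w : Fin (n ^ n) → Fin (n ^ n) → ℕ
      w i j = weight (fun i) (fun j)

    tally-+ : ∀ f g → tally (λ φ ψ → f φ ψ + g φ ψ) ≡ tally f + tally g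
    tally-+ f g = begin
      tally (λ φ ψ → f φ ψ + g φ ψ)
        ≡⟨ tally-cong (λ {φ} {ψ} _ → cong (f φ ψ +_) (sym (+-identityʳ (g φ ψ)))) ⟩
      tally (λ φ ψ → Σ[ 2 ] λ x → h x φ ψ)
        ≡⟨ tally-Σ 2 h ⟩
      tally f + (tally g + 0)
        ≡⟨ cong (tally f +_) (+-identityʳ (tally g)) ⟩
      tally f + tally g ∎
      where
      open ≡-Reasoning
      h : Fin 2 → SelfMap n → SelfMap n → ℕ
      h zero = f
      h (suc _) = g

    tally-* : ∀ k f → tally (λ φ ψ → f φ ψ * k) ≡ tally f * k
    tally-* k f = begin
      tally (λ φ ψ → f φ ψ * k)            ≡⟨ tally-cong (λ {φ} {ψ} _ → trans (*-comm (f φ ψ) k) (sym (Σ-const k (f φ ψ)))) ⟩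
      tally (λ φ ψ → Σ[ k ] λ _ → f φ ψ)   ≡⟨ tally-Σ k (λ _ → f) ⟩
      Σ[ k ] (λ _ → tally f)               ≡⟨ Σ-const k (tally f) ⟩
      k * tally f                          ≡⟨ *-comm k _ ⟩
      tally f * k                          ∎
      where open ≡-Reasoning

    tally-const : ∀ k → tally (λ _ _ → k) ≡ k * order
    tally-const k = begin
      tally (λ _ _ → k)      ≡⟨ tally-cong (λ _ → sym (+-identityʳ k)) ⟩
      tally (λ _ _ → 1 * k)  ≡⟨ tally-* k (λ _ _ → 1) ⟩
      order * k              ≡⟨ *-comm order k ⟩
      k * order              ∎
      where open ≡-Reasoning

    0<order : 0 < order
    0<order = begin
      1                                              ≡⟨ cong 𝟙 (sym (dec-true (twoFold? m (fun i) (fun i)) tf)) ⟩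
      weight (fun i) (fun i)                         ≡⟨ *-identityʳ _ ⟨
      weight (fun i) (fun i) * 1                     ≤⟨ term≤Σ (λ j → weight (fun i) (fun j) * 1) i ⟩
      Σ[ n ^ n ] (λ j → weight (fun i) (fun j) * 1)  ≤⟨ term≤Σ (λ i → Σ[ n ^ n ] λ j → weight (fun i) (fun j) * 1) i ⟩
      order                                          ∎
      where
      open ≤-Reasoning
      i : Fin (n ^ n)
      i = funToFin {n} {n} id
      fun-i : id ≗ fun i
      fun-i x = sym (finToFun-funToFin {n} {n} id x)
      tf : TwoFold m (fun i) (fun i)
      tf = twoFold-cong fun-i fun-i twoFold-id

    -- For undirected m, exchanging the two components permutes the group.
    tally-flip : Undirected m → ∀ f → tally (λ φ ψ → f ψ φ) ≡ tally f
    tally-flip und f = trans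
      (Σ-swap λ i j → weight (fun i) (fun j) * f (fun j) (fun i))
      (Σ-cong λ j → Σ-cong λ i → cong (λ b → 𝟙 b * f (fun j) (fun i))
        (does-⇔ (mk⇔ (twoFold-flip und) (twoFold-flip und)) (twoFold? m (fun i) (fun j)) (twoFold? m (fun j) (fun i))))

    -- Invariance under right translation. Precomposition with a bijection is injective on codes,
    -- hence permutes all pairs of self-maps; by `twoFold-∘` and `twoFold-cancelʳ` it preserves
    -- being two-fold in both directions, hence the weights.
    tally-∘ : ∀ {f} → Extensional f → ∀ {φ′ ψ′} → TwoFold m φ′ ψ′ →
      tally (λ φ ψ → f (φ ∘ φ′) (ψ ∘ ψ′)) ≡ tally f
    tally-∘ {f} ext {φ′} {ψ′} t = begin
      tally (λ φ ψ → f (φ ∘ φ′) (ψ ∘ ψ′))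
        ≡⟨ Σ-cong (λ i → Σ-cong λ j → sym (same i j)) ⟩
      Σ[ n ^ n ] (λ i → Σ[ n ^ n ] λ j → g (ρ φ′ i) (ρ ψ′ j))
        ≡⟨ Σ-cong (λ i → Σ-injection (g (ρ φ′ i)) (ρ-injective (injectiveʳ t))) ⟩
      Σ[ n ^ n ] (λ i → Σ[ n ^ n ] λ j → g (ρ φ′ i) j)
        ≡⟨ Σ-injection (λ i → Σ[ n ^ n ] (g i)) (ρ-injective (injectiveˡ t)) ⟩
      tally f ∎
      where
      open ≡-Reasoning
      g : Fin (n ^ n) → Fin (n ^ n) → ℕ
      g i j = weight (fun i) (fun j) * f (fun i) (fun j)
      ρ : SelfMap n → Fin (n ^ n) → Fin (n ^ n)
      ρ θ i = funToFin {n} {n} (fun i ∘ θ)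
      fun-ρ : ∀ θ i → fun (ρ θ i) ≗ fun i ∘ θ
      fun-ρ θ i = finToFun-funToFin {n} {n} (fun i ∘ θ)
      funToFin-cong : ∀ {k l} {a b : Fin k → Fin l} → a ≗ b → funToFin a ≡ funToFin b
      funToFin-cong {zero}  e = refl
      funToFin-cong {suc k} e = cong₂ combine (e zero) (funToFin-cong (e ∘ suc))
      ρ-injective : ∀ {θ} → Injective _≡_ _≡_ θ → Injective _≡_ _≡_ (ρ θ)
      ρ-injective {θ} inj {i} {j} eq = trans (sym (funToFin-finToFin {n} {n} i)) (trans (funToFin-cong agree) (funToFin-finToFin {n} {n} j))
        where
        agree : fun i ≗ fun j
        agree y with injective⇒surjective inj y
        ... | x , refl = trans (sym (fun-ρ θ i x)) (trans (cong (λ k → fun k x) eq) (fun-ρ θ j x))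
      same : ∀ i j → g (ρ φ′ i) (ρ ψ′ j) ≡ weight (fun i) (fun j) * f (fun i ∘ φ′) (fun j ∘ ψ′)
      same i j = cong₂ _*_
        (cong 𝟙 (does-⇔ (mk⇔
          (twoFold-cancelʳ t ∘ twoFold-cong (fun-ρ φ′ i) (fun-ρ ψ′ j))
          (λ s → twoFold-cong (sym ∘ fun-ρ φ′ i) (sym ∘ fun-ρ ψ′ j) (twoFold-∘ s t)))
          (twoFold? m _ _) (twoFold? m _ _)))
        (ext (fun-ρ φ′ i) (fun-ρ ψ′ j))

    -- For a random (φ , ψ) the vertex φ x is uniform: right translation and transitivity make the
    -- average independent of x, and averaging over x as well gives the plain mean of B, since each
    -- φ permutes the vertices.
    uniformˡ : TwoFoldTransitive m → ∀ (B : Fin n → ℕ) x → n * tally (λ φ _ → B (φ x)) ≡ Σ[ n ] B * order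
    uniformˡ trs B x = begin
      n * tally (λ φ _ → B (φ x))             ≡⟨ Σ-const n _ ⟨
      Σ[ n ] (λ y → tally (λ φ _ → B (φ x)))  ≡⟨ Σ-cong independent ⟩
      Σ[ n ] (λ y → tally (λ φ _ → B (φ y)))  ≡⟨ tally-Σ n (λ y φ _ → B (φ y)) ⟨
      tally (λ φ _ → Σ[ n ] (B ∘ φ))          ≡⟨ tally-cong (λ t → Σ-injection B (injectiveˡ t)) ⟩
      tally (λ _ _ → Σ[ n ] B)                ≡⟨ tally-const _ ⟩
      Σ[ n ] B * order                        ∎
      where
      open ≡-Reasoning
      independent : ∀ y → tally (λ φ _ → B (φ x)) ≡ tally (λ φ _ → B (φ y))
      independent y with trs x y
      ... | φ′ , ψ′ , t , refl = sym (tally-∘ (λ e _ → cong B (e x)) t)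

    uniformʳ : Undirected m → TwoFoldTransitive m →
      ∀ (B : Fin n → ℕ) x → n * tally (λ _ ψ → B (ψ x)) ≡ Σ[ n ] B * order
    uniformʳ und trs B x = trans (cong (n *_) (tally-flip und (λ φ _ → B (φ x)))) (uniformˡ trs B x)

-- Signs, partial 2-colourings and their classes

infixr 7 _·_

-- The product of signs, with true as the unit; hence also equality of booleans.
_·_ : Bool → Bool → Bool
true  · t = t
false · t = not t

·-assoc : ∀ r s t → (r · s) · t ≡ r · (s · t)
·-assoc true  _     _     = refl
·-assoc false true  _     = refl
·-assoc false false true  = refl
·-assoc false false false = refl

·-not : ∀ s t → s · not t ≡ not (s · t)
·-not true  _ = refl
·-not false _ = refl

·≡true⇒≡ : ∀ {s t} → s · t ≡ true → s ≡ t
·≡true⇒≡ {true}  {true}  _ = refl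
·≡true⇒≡ {false} {false} _ = refl

·-cancelʳ : ∀ {s s′ t} → s · t ≡ s′ · t → s ≡ s′
·-cancelʳ {true}  {true}          _ = refl
·-cancelʳ {false} {false}         _ = refl
·-cancelʳ {true}  {false} {true}  ()
·-cancelʳ {true}  {false} {false} ()
·-cancelʳ {false} {true}  {true}  ()
·-cancelʳ {false} {true}  {false} ()

-- A partial 2-colouring takes values in Maybe Bool: for a pair (L , R) it is
-- just true on L, just false on R and nothing elsewhere.
is : Bool → Maybe Bool → Bool
is t nothing  = false
is t (just a) = t · a

agree : Bool → Maybe Bool → Maybe Bool → Bool
agree s nothing  _ = false
agree s (just a) b = is (s · a) b

proper : Maybe Bool → Maybe Bool → Bool
proper nothing  _ = true
proper (just a) b = is (not a) b

is-disjoint : ∀ t a → 𝟙 (is t a) + 𝟙 (is (not t) a) ≤ 1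
is-disjoint _     nothing      = z≤n
is-disjoint true  (just true)  = ≤-refl
is-disjoint true  (just false) = ≤-refl
is-disjoint false (just true)  = ≤-refl
is-disjoint false (just false) = ≤-refl

is-true : ∀ {t a} → is t a ≡ true → a ≡ just t
is-true {t} {just a} eq = cong just (sym (·≡true⇒≡ {t} {a} eq))

agree-true : ∀ {s a b} → agree s a b ≡ true → ∃ λ t → a ≡ just t × b ≡ just (s · t)
agree-true {s} {just t} {b} eq = t , refl , is-true {s · t} {b} eq

agree-unique : ∀ {s s′ a b} → agree s a b ≡ true → agree s′ a b ≡ true → s ≡ s′
agree-unique {s} {s′} {a} {b} h h′ with agree-true {s} {a} {b} h | agree-true {s′} {a} {b} h′
... | t , refl , refl | .t , refl , eq = ·-cancelʳ {t = t} (just-injective eq)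

agree-∘ : ∀ {s s′ a b c} → agree s′ a b ≡ true → agree s b c ≡ true → agree (s · s′) a c ≡ true
agree-∘ {s} {s′} {a} {b} {c} h h′ with agree-true {s′} {a} {b} h
... | t , refl , refl = trans (cong (λ u → is u c) (·-assoc s s′ t)) h′

-- Compares a = χ x, b = χ (φ x) and c = χ (ψ x), for the two sides φ and ψ of
-- a two-fold automorphism: the class is (true , s) if b = c = s · a, and
-- (false , t) if b = t and c = not t. Moving along an edge on which all
-- colourings involved are proper negates the three colours and swaps the last
-- two, so it preserves the class.
class : Maybe Bool → Maybe Bool → Maybe Bool → Maybe (Bool × Bool)
class (just a) (just b) (just c) = just (b · c , (if b · c then a · b else b))
class _        _        _        = nothing

class-flip : ∀ a b c → class (just (not a)) (just (not c)) (just (not b)) ≡ class (just a) (just b) (just c)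
class-flip true  true  true  = refl
class-flip true  true  false = refl
class-flip true  false true  = refl
class-flip true  false false = refl
class-flip false true  true  = refl
class-flip false true  false = refl
class-flip false false true  = refl
class-flip false false false = refl

holds : (Bool × Bool → Bool) → Maybe (Bool × Bool) → Bool
holds q = maybe q false

-- The primed colours belong to the other end y of an edge x y. Its translates are φ x , ψ y and ψ x
-- , φ y, so `b` is matched with `c′` and `c` with `b′`.
class-invariant : ∀ q a b c {a′ b′ c′} → holds q (class a b c) ≡ true →
  proper a a′ ≡ true → proper b c′ ≡ true → proper c b′ ≡ true → holds q (class a′ b′ c′) ≡ true
class-invariant q (just a) (just b) (just c) {a′} {b′} {c′} h p₁ p₂ p₃
  with is-true {not a} {a′} p₁ | is-true {not b} {c′} p₂ | is-true {not c} {b′} p₃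
... | refl | refl | refl = trans (cong (holds q) (class-flip a b c)) h

key : Bool × Bool → Bool × Bool → Bool
key (r , s) (r′ , s′) = (r · r′) ∧ (s · s′)

class-same : ∀ s a b c → holds (key (true , s)) (class a b c) ≡ true →
  agree s a b ≡ true × agree s a c ≡ true
class-same true  (just true)  (just true)  (just true)  _ = refl , refl
class-same true  (just false) (just false) (just false) _ = refl , refl
class-same false (just true)  (just false) (just false) _ = refl , refl
class-same false (just false) (just true)  (just true)  _ = refl , refl
class-same true (just true) (just true) (just false) ()
class-same true (just true) (just false) (just false) ()
class-same true (just false) (just true) (just true) ()
class-same true (just false) (just false) (just true) ()
class-same false (just true) (just true) (just true) ()
class-same false (just true) (just false) (just true) ()
class-same false (just false) (just true) (just false) ()
class-same false (just false) (just false) (just false) ()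

-- Confines a mixed class to the preimage of one colour under φ, so that balance of the colours
-- keeps it from being almost everything.
class-mixed : ∀ t a b c → holds (key (false , t)) (class a b c) ≡ true → is t b ≡ true
class-mixed true  (just _) (just true)  (just false) _ = refl
class-mixed false (just _) (just false) (just true)  _ = refl
class-mixed true (just _) (just true) (just true) ()
class-mixed true (just _) (just false) (just true) ()
class-mixed false (just _) (just true) (just false) ()
class-mixed false (just _) (just false) (just false) ()

holds-split : ∀ q k → 𝟙 (holds q k) + 𝟙 (holds (not ∘ q) k) + 𝟙 (is-nothing k) ≡ 1
holds-split q nothing = refl
holds-split q (just k) with q k
... | true  = refl
... | false = refl

holds-cover : ∀ k → 1 ≤ 𝟙 (holds (key (true , true)) k) + 𝟙 (holds (key (true , false)) k)
  + (𝟙 (holds (key (false , true)) k) + 𝟙 (holds (key (false , false)) k)) + 𝟙 (is-nothing k)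
holds-cover nothing                = ≤-refl
holds-cover (just (true  , true))  = ≤-refl
holds-cover (just (true  , false)) = ≤-refl
holds-cover (just (false , true))  = ≤-refl
holds-cover (just (false , false)) = ≤-refl

class-nothing : ∀ a b c → 𝟙 (is-nothing (class a b c)) ≤ 𝟙 (is-nothing a) + (𝟙 (is-nothing b) + 𝟙 (is-nothing c))
class-nothing nothing  _        _        = s≤s z≤n
class-nothing (just _) nothing  _        = s≤s z≤n
class-nothing (just _) (just _) nothing  = ≤-refl
class-nothing (just _) (just _) (just _) = z≤n

-- Majorities and degree counts

𝟙-mono : ∀ {a b} → (a ≡ true → b ≡ true) → 𝟙 a ≤ 𝟙 b
𝟙-mono {false} _ = z≤n
𝟙-mono {true}  h = ≤-reflexive (cong 𝟙 (sym (h refl)))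

#-mono : ∀ {n} {p q : Fin n → Bool} → (∀ x → p x ≡ true → q x ≡ true) → # p ≤ # q
#-mono h = Σ-mono λ x → 𝟙-mono (h x)

-- Union bound: each complement has fewer than n / 10 points, and three of these do not cover.
common-point : ∀ {n} {p q r : Fin n → Bool} → n * 9 < # p * 10 → n * 9 < # q * 10 → n * 9 < # r * 10 →
  ∃ λ x → p x ≡ true × q x ≡ true × r x ≡ true
common-point {n} {p} {q} {r} hp hq hr
  with any? (λ x → (p x ≟ᵇ true) ×-dec ((q x ≟ᵇ true) ×-dec (r x ≟ᵇ true)))
... | yes w = w
... | no ¬w = contradiction bound (<⇒≱ (lin {l = 1 + (n * 9) + (1 + (n * 9) + (1 + n * 9))} (2 + n * 7)
                (+-mono-≤ hp (+-mono-≤ hq hr)) (id₁ n (# p) (# q) (# r))))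
  where
  two : ∀ a b c → ¬ (a ≡ true × b ≡ true × c ≡ true) → 𝟙 a + (𝟙 b + 𝟙 c) ≤ 2
  two true  true  true  h = contradiction (refl , refl , refl) h
  two true  true  false h = ≤-refl
  two true  false true  h = ≤-refl
  two true  false false h = s≤s z≤n
  two false true  true  h = ≤-refl
  two false true  false h = s≤s z≤n
  two false false true  h = s≤s z≤n
  two false false false h = z≤n
  sums : # p + (# q + # r) ≤ n * 2
  sums = begin
    # p + (# q + # r)                                ≡⟨ cong (# p +_) (Σ-+ (𝟙 ∘ q) (𝟙 ∘ r)) ⟨
    # p + Σ[ n ] (λ x → 𝟙 (q x) + 𝟙 (r x))           ≡⟨ Σ-+ (𝟙 ∘ p) _ ⟨
    Σ[ n ] (λ x → 𝟙 (p x) + (𝟙 (q x) + 𝟙 (r x)))     ≤⟨ Σ-mono (λ x → two (p x) (q x) (r x) (λ w → ¬w (x , w))) ⟩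
    Σ[ n ] (λ _ → 2)                                 ≡⟨ Σ-const n 2 ⟩
    n * 2                                            ∎
    where open ≤-Reasoning
  bound : (# p + (# q + # r)) * 10 ≤ (n * 2) * 10
  bound = *-monoˡ-≤ 10 sums
  id₁ : ∀ n x y z → 1 + (n * 2) * 10 + (x * 10 + (y * 10 + z * 10)) + (2 + n * 7)
    ≡ (x + (y + z)) * 10 + (1 + n * 9 + (1 + n * 9 + (1 + n * 9)))
  id₁ = solve-∀

Σ-degreeˡ : ∀ {n} {m : Graph n} {d} → Regular m d → ∀ f →
  Σ[ n ] (λ x → Σ[ n ] λ y → f x * m x y) ≡ d * Σ[ n ] f
Σ-degreeˡ {n} {m} {d} reg f = begin
  Σ[ n ] (λ x → Σ[ n ] λ y → f x * m x y)  ≡⟨ Σ-cong (λ x → Σ-*ˡ (f x) (m x)) ⟩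
  Σ[ n ] (λ x → f x * Σ[ n ] (m x))        ≡⟨ Σ-cong (λ x → trans (cong (f x *_) (reg x)) (*-comm (f x) d)) ⟩
  Σ[ n ] (λ x → d * f x)                   ≡⟨ Σ-*ˡ d f ⟩
  d * Σ[ n ] f                             ∎
  where open ≡-Reasoning

Σ-degreeʳ : ∀ {n} {m : Graph n} {d} → Regular m d → Undirected m → ∀ f →
  Σ[ n ] (λ x → Σ[ n ] λ y → f y * m x y) ≡ d * Σ[ n ] f
Σ-degreeʳ {n} {m} reg und f = trans (Σ-swap λ x y → f y * m x y)
  (trans (Σ-cong λ y → Σ-cong λ x → cong (f y *_) (und x y)) (Σ-degreeˡ reg f))

nonBipartite⇒0<n : ∀ {n} {m : Graph n} → NonBipartite m → 0 < n
nonBipartite⇒0<n {zero}  nb = contradiction ((λ _ → true) , λ ()) nb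
nonBipartite⇒0<n {suc n} nb = s≤s z≤n

nonBipartite⇒0<d : ∀ {n} {m : Graph n} {d} → Regular m d → NonBipartite m → 0 < d
nonBipartite⇒0<d {m = m} {zero} reg nb = contradiction
  ((λ _ → true) , λ x y _ → n≤0⇒n≡0 (subst (m x y ≤_) (reg x) (term≤Σ (m x) y))) nb
nonBipartite⇒0<d {d = suc d} reg nb = s≤s z≤n

-- Lets a boolean witness be defined by testing `true` alone, independently of the existence proof;
-- `sign` and `winner` are defined so.
does-satisfies : (P : Bool → Set) (P? : Dec (P true)) → ∃ P → P (does P?)
does-satisfies P (yes h) _           = h
does-satisfies P (no ¬h) (true  , h) = contradiction h ¬h
does-satisfies P (no ¬h) (false , h) = h

-- From an almost proper partial colouring to a bipartition

-- The 30 is 90 / 3: the boundary of a set p as in no-sparse-cut is at most three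
-- times the numerator of the bipartiteness ratio. An improper edge x y is charged
-- to x by B₁ (edge case) or to y by B₂ (vertex case).
module Averaging {n : ℕ} (m : Graph n) (d : ℕ)
  (reg : Regular m d) (und : Undirected m) (nb : NonBipartite m) (trs : TwoFoldTransitive m)
  (χ : Fin n → Maybe Bool) (B₁ B₂ : Fin n → ℕ)
  (bad : ∀ x y → m x y ≢ 0 → proper (χ x) (χ y) ≡ false → 1 ≤ B₁ x + B₂ y)
  (few-bad : (Σ[ n ] B₁ + Σ[ n ] B₂) * 60 ≤ n)
  (few-uncoloured : # (is-nothing ∘ χ) * 45 ≤ n)
  (no-sparse-cut : ∀ {φ ψ} → TwoFold m φ ψ → (p : Fin n → Bool) →
    (∀ x y → m x y ≢ 0 → p x ≡ true → proper (χ x) (χ y) ≡ true →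
      proper (χ (φ x)) (χ (ψ y)) ≡ true → proper (χ (ψ x)) (χ (φ y)) ≡ true → p y ≡ true) →
    # p * 2 ≤ n → # p * 30 < n)
  where

  open Tally m

  module _ {φ ψ : SelfMap n} (t : TwoFold m φ ψ) where

    cls : Fin n → Maybe (Bool × Bool)
    cls x = class (χ x) (χ (φ x)) (χ (ψ x))

    class-size : (Bool × Bool → Bool) → ℕ
    class-size q = # (holds q ∘ cls)

    unclassified : ℕ
    unclassified = # (is-nothing ∘ cls)

    -- A vertex is unclassified only if x, φ x or ψ x is uncoloured: 3 / 45 = 1 / 15.
    few-unclassified : unclassified * 15 ≤ n
    few-unclassified = *-cancelʳ-≤ _ _ 3 (begin
      (unclassified * 15) * 3   ≤⟨ *-monoˡ-≤ 3 (*-monoˡ-≤ 15 thrice) ⟩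
      ((c + (c + c)) * 15) * 3  ≡⟨ id₁ c ⟩
      (c * 45) * 3              ≤⟨ *-monoˡ-≤ 3 few-uncoloured ⟩
      n * 3                     ∎)
      where
      open ≤-Reasoning
      c : ℕ
      c = # (is-nothing ∘ χ)
      id₁ : ∀ c → ((c + (c + c)) * 15) * 3 ≡ (c * 45) * 3
      id₁ = solve-∀
      o : Fin n → ℕ
      o = 𝟙 ∘ is-nothing ∘ χ
      thrice : unclassified ≤ c + (c + c)
      thrice = begin
        unclassified                                  ≤⟨ Σ-mono (λ x → class-nothing (χ x) (χ (φ x)) (χ (ψ x))) ⟩
        Σ[ n ] (λ x → o x + (o (φ x) + o (ψ x)))      ≡⟨ Σ-+ o _ ⟩
        c + Σ[ n ] (λ x → o (φ x) + o (ψ x))          ≡⟨ cong (c +_) (Σ-+ (o ∘ φ) (o ∘ ψ)) ⟩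
        c + (Σ[ n ] (o ∘ φ) + Σ[ n ] (o ∘ ψ))         ≡⟨ cong (c +_) (cong₂ _+_ (Σ-injection o (injectiveˡ t)) (Σ-injection o (injectiveʳ t))) ⟩
        c + (c + c)                                   ∎

    class-total : ∀ q → class-size q + class-size (not ∘ q) + unclassified ≡ n
    class-total q = begin
      class-size q + class-size (not ∘ q) + unclassified
        ≡⟨ cong (_+ unclassified) (Σ-+ (𝟙 ∘ holds q ∘ cls) (𝟙 ∘ holds (not ∘ q) ∘ cls)) ⟨
      Σ[ n ] (λ x → 𝟙 (holds q (cls x)) + 𝟙 (holds (not ∘ q) (cls x))) + unclassified
        ≡⟨ Σ-+ (λ x → 𝟙 (holds q (cls x)) + 𝟙 (holds (not ∘ q) (cls x))) (𝟙 ∘ is-nothing ∘ cls) ⟨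
      Σ[ n ] (λ x → 𝟙 (holds q (cls x)) + 𝟙 (holds (not ∘ q) (cls x)) + 𝟙 (is-nothing (cls x)))
        ≡⟨ Σ-cong (λ x → holds-split q (cls x)) ⟩
      Σ[ n ] (λ _ → 1)
        ≡⟨ trans (Σ-const n 1) (*-identityʳ n) ⟩
      n ∎
      where open ≡-Reasoning

    class-sparse : ∀ q → class-size q * 2 ≤ n → class-size q * 30 < n
    class-sparse q = no-sparse-cut t (holds q ∘ cls)
      (λ x y _ → class-invariant q (χ x) (χ (φ x)) (χ (ψ x)))

    -- If the union exceeds n / 2, its complementary union is below n / 2, hence below n / 30, and
    -- what remains is more than 1 - 1/30 - 1/15 = 9/10 of the vertices.
    class-dichotomy : ∀ q → class-size q * 30 < n ⊎ n * 9 < class-size q * 10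
    class-dichotomy q with class-size q * 2 ≤? n
    ... | yes small = inj₁ (class-sparse q small)
    ... | no ¬small = inj₂ (*-cancelʳ-< 3 _ _ (lin 0 (+-mono-≤ (class-sparse (not ∘ q) other-small) (*-monoˡ-≤ 2 few-unclassified)) id₂))
      where
      u v z : ℕ
      u = class-size q
      v = class-size (not ∘ q)
      z = unclassified
      id₁ : ∀ u v z → v * 2 + u * 2 + (1 + z * 2) ≡ u + v + z + (1 + (u + v + z))
      id₁ = solve-∀
      other-small : v * 2 ≤ n
      other-small = subst (v * 2 ≤_) (class-total q)
        (lin {l = 1 + (u + v + z)} (1 + z * 2) (subst (_< u * 2) (sym (class-total q)) (≰⇒> ¬small)) (id₁ u v z))
      id₃ : ∀ u v z → 1 + ((u + v + z) * 9) * 3 + (u + v + z + (u + v + z) * 2) + 0 ≡ (u * 10) * 3 + (1 + v * 30 + (z * 15) * 2)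
      id₃ = solve-∀
      id₂ : 1 + (n * 9) * 3 + (n + n * 2) + 0 ≡ (u * 10) * 3 + (1 + v * 30 + (z * 15) * 2)
      id₂ = subst (λ k → 1 + (k * 9) * 3 + (k + k * 2) + 0 ≡ (u * 10) * 3 + (1 + v * 30 + (z * 15) * 2)) (class-total q) (id₃ u v z)

  0<n : 0 < n
  0<n = nonBipartite⇒0<n nb

  colour-size : Bool → ℕ
  colour-size t = # (is t ∘ χ)

  colours-disjoint : ∀ t → colour-size t + colour-size (not t) ≤ n
  colours-disjoint t = begin
    colour-size t + colour-size (not t)                     ≡⟨ Σ-+ (𝟙 ∘ is t ∘ χ) (𝟙 ∘ is (not t) ∘ χ) ⟨
    Σ[ n ] (λ x → 𝟙 (is t (χ x)) + 𝟙 (is (not t) (χ x)))    ≤⟨ Σ-mono (λ x → is-disjoint t (χ x)) ⟩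
    Σ[ n ] (λ _ → 1)                                        ≡⟨ trans (Σ-const n 1) (*-identityʳ n) ⟩
    n                                                       ∎
    where
    open ≤-Reasoning

  -- Almost all edges leaving the colour t end in the colour not t.
  balanced : ∀ t → colour-size t * 10 ≤ n * 9
  balanced t = *-cancelʳ-≤ _ _ 12 (lin (n * 47)
      (+-mono-≤ (*-monoˡ-≤ 60 (+-mono-≤ imbalance (colours-disjoint t))) few-bad)
      (id₁ (colour-size t) (colour-size (not t)) (Σ[ n ] B₁ + Σ[ n ] B₂) n))
    where
    open ≤-Reasoning
    b : ℕ
    b = Σ[ n ] B₁ + Σ[ n ] B₂
    f₂ : Fin n → ℕ
    f₂ y = 𝟙 (is (not t) (χ y)) + B₂ y
    pointwise : ∀ x y → 𝟙 (is t (χ x)) * m x y ≤ B₁ x * m x y + f₂ y * m x y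
    pointwise x y with m x y in eq
    ... | zero  = ≤-reflexive (trans (*-zeroʳ (𝟙 (is t (χ x)))) (sym (cong₂ _+_ (*-zeroʳ (B₁ x)) (*-zeroʳ (f₂ y)))))
    ... | suc k = ≤-trans (*-monoˡ-≤ (suc k) count) (≤-reflexive (*-distribʳ-+ (suc k) (B₁ x) (f₂ y)))
      where
      count : 𝟙 (is t (χ x)) ≤ B₁ x + f₂ y
      count with is t (χ x) in eq₁
      ... | false = z≤n
      ... | true with is-true {t} {χ x} eq₁
      ...   | eq₂ with is (not t) (χ y) in eq₃
      ...     | true  = ≤-trans (s≤s z≤n) (m≤n+m (suc (B₂ y)) (B₁ x))
      ...     | false = bad x y (λ eq₄ → 1+n≢0 (trans (sym eq) eq₄)) (trans (cong (λ c → proper c (χ y)) eq₂) eq₃)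
    imbalance : colour-size t ≤ colour-size (not t) + b
    imbalance = *-cancelˡ-≤ d {{>-nonZero (nonBipartite⇒0<d reg nb)}} (begin
      d * colour-size t
        ≡⟨ Σ-degreeˡ reg (𝟙 ∘ is t ∘ χ) ⟨
      Σ[ n ] (λ x → Σ[ n ] λ y → 𝟙 (is t (χ x)) * m x y)
        ≤⟨ Σ-mono (λ x → Σ-mono λ y → pointwise x y) ⟩
      Σ[ n ] (λ x → Σ[ n ] λ y → B₁ x * m x y + f₂ y * m x y)
        ≡⟨ Σ-cong (λ x → Σ-+ (λ y → B₁ x * m x y) (λ y → f₂ y * m x y)) ⟩
      Σ[ n ] (λ x → Σ[ n ] (λ y → B₁ x * m x y) + Σ[ n ] (λ y → f₂ y * m x y))
        ≡⟨ Σ-+ (λ x → Σ[ n ] (λ y → B₁ x * m x y)) _ ⟩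
      Σ[ n ] (λ x → Σ[ n ] (λ y → B₁ x * m x y)) + Σ[ n ] (λ x → Σ[ n ] (λ y → f₂ y * m x y))
        ≡⟨ cong₂ _+_ (Σ-degreeˡ reg B₁) (Σ-degreeʳ reg und f₂) ⟩
      d * Σ[ n ] B₁ + d * Σ[ n ] f₂
        ≡⟨ *-distribˡ-+ d _ _ ⟨
      d * (Σ[ n ] B₁ + Σ[ n ] f₂)
        ≡⟨ cong (λ k → d * (Σ[ n ] B₁ + k)) (Σ-+ (𝟙 ∘ is (not t) ∘ χ) B₂) ⟩
      d * (Σ[ n ] B₁ + (colour-size (not t) + Σ[ n ] B₂))
        ≡⟨ id₂ d (Σ[ n ] B₁) (colour-size (not t)) (Σ[ n ] B₂) ⟩
      d * (colour-size (not t) + b) ∎)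
      where
      id₂ : ∀ d x y z → d * (x + (y + z)) ≡ d * (y + (x + z))
      id₂ = solve-∀
    id₁ : ∀ c c′ b n → (c * 10) * 12 + ((c′ + b + n) * 60 + n) + n * 47 ≡ (n * 9) * 12 + ((c + (c + c′)) * 60 + b * 60)
    id₁ = solve-∀

  Agrees : Bool → SelfMap n → Set
  Agrees s φ = n * 9 < # (λ x → agree s (χ x) (χ (φ x))) * 10

  -- The mixed classes are never large, by `balanced`. If neither class (true , s) were large, the
  -- four classes and the unclassified vertices would cover at most 4/30 + 1/15 = 1/5 of the graph.
  agrees-both : ∀ {φ ψ} → TwoFold m φ ψ → ∃ λ s → Agrees s φ × Agrees s ψ
  agrees-both {φ} {ψ} t = pick (class-dichotomy t (key (true , true))) (class-dichotomy t (key (true , false)))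
    where
    size : Bool × Bool → ℕ
    size k = class-size t (key k)
    large : ∀ s → n * 9 < size (true , s) * 10 → ∃ λ s → Agrees s φ × Agrees s ψ
    large s h = s
      , <-≤-trans h (*-monoˡ-≤ 10 (#-mono λ x → proj₁ ∘ class-same s (χ x) (χ (φ x)) (χ (ψ x))))
      , <-≤-trans h (*-monoˡ-≤ 10 (#-mono λ x → proj₂ ∘ class-same s (χ x) (χ (φ x)) (χ (ψ x))))
    mixed-small : ∀ s → size (false , s) * 30 < n
    mixed-small s with class-dichotomy t (key (false , s))
    ... | inj₁ h = h
    ... | inj₂ h = contradiction (balanced s) (<⇒≱ (<-≤-trans h (*-monoˡ-≤ 10 (begin
        size (false , s)              ≤⟨ #-mono (λ x → class-mixed s (χ x) (χ (φ x)) (χ (ψ x))) ⟩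
        Σ[ n ] (𝟙 ∘ is s ∘ χ ∘ φ)     ≡⟨ Σ-injection (𝟙 ∘ is s ∘ χ) (injectiveˡ t) ⟩
        colour-size s                 ∎))))
      where open ≤-Reasoning
    cover : n ≤ size (true , true) + size (true , false) + (size (false , true) + size (false , false)) + unclassified t
    cover = begin
      n ≡⟨ trans (Σ-const n 1) (*-identityʳ n) ⟨
      Σ[ n ] (λ _ → 1) ≤⟨ Σ-mono (λ x → holds-cover (cls t x)) ⟩
      Σ[ n ] (λ x → h (true , true) x + h (true , false) x + (h (false , true) x + h (false , false) x) + 𝟙 (is-nothing (cls t x)))
        ≡⟨ Σ-+ (λ x → h (true , true) x + h (true , false) x + (h (false , true) x + h (false , false) x)) _ ⟩
      Σ[ n ] (λ x → h (true , true) x + h (true , false) x + (h (false , true) x + h (false , false) x)) + unclassified t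
        ≡⟨ cong (_+ unclassified t) (trans (Σ-+ (λ x → h (true , true) x + h (true , false) x) _)
             (cong₂ _+_ (Σ-+ (h (true , true)) _) (Σ-+ (h (false , true)) _))) ⟩
      _ ∎
      where
      open ≤-Reasoning
      h : Bool × Bool → Fin n → ℕ
      h k x = 𝟙 (holds (key k) (cls t x))
    id₁ : ∀ a b c e z n → n + (n + n + (n + n) + n * 2 + (a + b + (c + e) + z) * 30) + (4 + n * 23)
      ≡ 0 + (1 + a * 30 + (1 + b * 30) + (1 + c * 30 + (1 + e * 30)) + (z * 15) * 2 + n * 30)
    id₁ = solve-∀
    pick : size (true , true) * 30 < n ⊎ n * 9 < size (true , true) * 10 →
      size (true , false) * 30 < n ⊎ n * 9 < size (true , false) * 10 → ∃ λ s → Agrees s φ × Agrees s ψ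
    pick (inj₂ h) _        = large true h
    pick _        (inj₂ h) = large false h
    pick (inj₁ h) (inj₁ h′) = contradiction 0<n (≤⇒≯ (lin (4 + n * 23)
      (+-mono-≤ (+-mono-≤ (+-mono-≤ (+-mono-≤ h h′) (+-mono-≤ (mixed-small true) (mixed-small false)))
        (*-monoˡ-≤ 2 (few-unclassified t))) (*-monoˡ-≤ 30 cover))
      (id₁ (size (true , true)) (size (true , false)) (size (false , true)) (size (false , false)) (unclassified t) n)))

  agrees-unique : ∀ {s s′ φ} → Agrees s φ → Agrees s′ φ → s ≡ s′
  agrees-unique {s} {s′} {φ} h h′ with common-point h h′ h′
  ... | x , p , q , _ = agree-unique {s} {s′} {χ x} {χ (φ x)} p q

  -- Since φ′ is a bijection, the majority for φ pulls back along it to a set of the same size; at a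
  -- vertex common to all three majorities the signs multiply.
  agrees-∘ : ∀ {s s′ s″ φ φ′} → Injective _≡_ _≡_ φ′ → Agrees s φ → Agrees s′ φ′ → Agrees s″ (φ ∘ φ′) → s″ ≡ s · s′
  agrees-∘ {s} {s′} {s″} {φ} {φ′} inj h h′ h″
    with common-point (subst (λ k → n * 9 < k * 10) (sym (Σ-injection (λ x → 𝟙 (agree s (χ x) (χ (φ x)))) inj)) h) h′ h″
  ... | x , p , q , r = agree-unique {s″} {s · s′} {χ x} {χ (φ (φ′ x))} r
    (agree-∘ {s} {s′} {χ x} {χ (φ′ x)} {χ (φ (φ′ x))} q p)

  abstract

    sign : SelfMap n → Bool
    sign φ = does (n * 9 <? # (λ x → agree true (χ x) (χ (φ x))) * 10)

    sign-agrees : ∀ {φ ψ} → TwoFold m φ ψ → Agrees (sign φ) φ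
    sign-agrees {φ} t with agrees-both t
    ... | s , h , _ = does-satisfies (λ s → Agrees s φ) (n * 9 <? # (λ x → agree true (χ x) (χ (φ x))) * 10) (s , h)

    sign-cong : ∀ {φ φ′} → φ ≗ φ′ → sign φ ≡ sign φ′
    sign-cong e = cong (λ k → does (n * 9 <? k * 10)) (Σ-cong λ x → cong (λ y → 𝟙 (agree true (χ x) (χ y))) (e x))

  -- Lets the vote of (φ , ψ) at one end of an edge be compared with that of (ψ , φ) at the other
  -- end.
  sign-flip : ∀ {φ ψ} → TwoFold m φ ψ → sign φ ≡ sign ψ
  sign-flip t with agrees-both t
  ... | _ , h , h′ = trans (agrees-unique (sign-agrees t) h) (agrees-unique h′ (sign-agrees (twoFold-flip und t)))

  sign-∘ : ∀ {φ ψ φ′ ψ′} → TwoFold m φ ψ → TwoFold m φ′ ψ′ → sign (φ ∘ φ′) ≡ sign φ · sign φ′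
  sign-∘ t t′ = agrees-∘ (injectiveˡ t′) (sign-agrees t) (sign-agrees t′) (sign-agrees (twoFold-∘ t t′))

  vote : Bool → Fin n → SelfMap n → SelfMap n → ℕ
  vote t x φ _ = 𝟙 (is (sign φ · t) (χ (φ x)))

  vote-ext : ∀ t x → Extensional (vote t x)
  vote-ext t x e _ = cong₂ (λ s y → 𝟙 (is (s · t) (χ y))) (sign-cong e) (e x)

  votes : Bool → Fin n → ℕ
  votes t x = tally (vote t x)

  votes-disjoint : ∀ t x → votes t x + votes (not t) x ≤ order
  votes-disjoint t x = ≤-trans (≤-reflexive (sym (tally-+ (vote t x) (vote (not t) x)))) (tally-mono λ {φ} _ →
    subst (λ u → 𝟙 (is (sign φ · t) (χ (φ x))) + 𝟙 (is u (χ (φ x))) ≤ 1) (sym (·-not (sign φ) t))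
      (is-disjoint (sign φ · t) (χ (φ x))))

  -- Equivariance: replacing each φ by φ ∘ φ′ multiplies its sign by that of φ′.
  votes-translate : ∀ {φ′ ψ′} → TwoFold m φ′ ψ′ → ∀ t x → votes t x ≡ votes (sign φ′ · t) (φ′ x)
  votes-translate {φ′} t′ t x = trans (sym (tally-∘ (vote-ext t x) t′)) (tally-cong λ {φ} s →
    cong (λ u → 𝟙 (is u (χ (φ (φ′ x))))) (trans (cong (_· t) (sign-∘ s t′)) (·-assoc (sign φ) (sign φ′) t)))

  -- For c = `just t` this reduces to `vote t x`; for `nothing` it is 0. So `score x` counts the
  -- votes at x in favour of the colour that χ itself gives to x.
  ballot : Maybe Bool → Fin n → SelfMap n → SelfMap n → ℕ
  ballot c x φ _ = 𝟙 (agree (sign φ) c (χ (φ x)))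

  score : Fin n → ℕ
  score x = tally (ballot (χ x) x)

  -- Double counting: each (φ , ψ) votes as χ does at more than 9/10 of the vertices, by
  -- `sign-agrees`. Some vertex must then reach this proportion over the group.
  score-total : n * 9 * order < Σ[ n ] score * 10
  score-total = begin-strict
    n * 9 * order                                             <⟨ m<n+m _ 0<order ⟩
    (1 + n * 9) * order                                       ≡⟨ tally-const (1 + n * 9) ⟨
    tally (λ _ _ → 1 + n * 9)                                 ≤⟨ tally-mono sign-agrees ⟩
    tally (λ φ ψ → (Σ[ n ] λ x → ballot (χ x) x φ ψ) * 10)    ≡⟨ tally-* 10 (λ φ ψ → Σ[ n ] λ x → ballot (χ x) x φ ψ) ⟩
    tally (λ φ ψ → Σ[ n ] λ x → ballot (χ x) x φ ψ) * 10      ≡⟨ cong (_* 10) (tally-Σ n (λ x → ballot (χ x) x)) ⟩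
    Σ[ n ] score * 10                                         ∎
    where open ≤-Reasoning

  high-score : ∃ λ x → order * 9 < score x * 10
  high-score = Σ-< (λ _ → order * 9) (λ x → score x * 10) (subst₂ _<_
    (trans (id₁ n order) (sym (Σ-const n _))) (sym (Σ-*ʳ 10 score)) score-total)
    where
    id₁ : ∀ n k → n * 9 * k ≡ n * (k * 9)
    id₁ = solve-∀

  some-landslide : ∃₂ λ t x → order * 9 < votes t x * 10
  some-landslide = pick high-score
    where
    coloured : ∀ c x → order * 9 < tally (ballot c x) * 10 → ∃₂ λ t x → order * 9 < votes t x * 10
    coloured (just t) x h = t , x , h
    coloured nothing  x h = contradiction h (≤⇒≯ (≤-trans (≤-reflexive (cong (_* 10) (tally-const 0))) z≤n))
    pick : (∃ λ x → order * 9 < score x * 10) → ∃₂ λ t x → order * 9 < votes t x * 10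
    pick (x , h) = coloured (χ x) x h

  landslide : ∀ y → ∃ λ t → order * 9 < votes t y * 10
  landslide y = move some-landslide
    where
    move : (∃₂ λ t x → order * 9 < votes t x * 10) → ∃ λ t → order * 9 < votes t y * 10
    move (t , x , h) = carry (trs x y)
      where
      carry : (∃₂ λ φ ψ → TwoFold m φ ψ × φ x ≡ y) → ∃ λ t → order * 9 < votes t y * 10
      carry (φ , _ , s , eq) = sign φ · t , subst (λ k → order * 9 < k * 10)
        (trans (votes-translate s t x) (cong (votes (sign φ · t)) eq)) h

  -- The expected charge of the translated edge is the mean of B₁ at φ x plus the mean of B₂ at ψ y,
  -- each over a uniform vertex; no joint distribution enters.
  few-improper : ∀ {x y} → m x y ≢ 0 → tally (λ φ ψ → 𝟙 (not (proper (χ (φ x)) (χ (ψ y))))) * 60 ≤ order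
  few-improper {x} {y} xy = *-cancelˡ-≤ n {{>-nonZero 0<n}} (begin
    n * (tally (λ φ ψ → 𝟙 (not (proper (χ (φ x)) (χ (ψ y))))) * 60)  ≤⟨ *-monoʳ-≤ n (*-monoˡ-≤ 60 (tally-mono improper)) ⟩
    n * (tally (λ φ ψ → B₁ (φ x) + B₂ (ψ y)) * 60)    ≡⟨ cong (λ k → n * (k * 60)) (tally-+ (λ φ _ → B₁ (φ x)) (λ _ ψ → B₂ (ψ y))) ⟩
    n * ((t₁ + t₂) * 60)                              ≡⟨ id₁ n t₁ t₂ ⟩
    (n * t₁ + n * t₂) * 60                            ≡⟨ cong (_* 60) (cong₂ _+_ (uniformˡ trs B₁ x) (uniformʳ und trs B₂ y)) ⟩
    (Σ[ n ] B₁ * order + Σ[ n ] B₂ * order) * 60      ≡⟨ id₂ (Σ[ n ] B₁) (Σ[ n ] B₂) order ⟩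
    (Σ[ n ] B₁ + Σ[ n ] B₂) * 60 * order              ≤⟨ *-monoˡ-≤ order few-bad ⟩
    n * order                                         ∎)
    where
    open ≤-Reasoning
    t₁ t₂ : ℕ
    t₁ = tally (λ φ _ → B₁ (φ x))
    t₂ = tally (λ _ ψ → B₂ (ψ y))
    id₁ : ∀ n a b → n * ((a + b) * 60) ≡ (n * a + n * b) * 60
    id₁ = solve-∀
    id₂ : ∀ a b k → (a * k + b * k) * 60 ≡ (a + b) * 60 * k
    id₂ = solve-∀
    improper : ∀ {φ ψ} → TwoFold m φ ψ → 𝟙 (not (proper (χ (φ x)) (χ (ψ y)))) ≤ B₁ (φ x) + B₂ (ψ y)
    improper {φ} {ψ} t with proper (χ (φ x)) (χ (ψ y)) in eq
    ... | true  = z≤n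
    ... | false = bad (φ x) (ψ y) (xy ∘ trans (sym (preserves t x y))) eq

  -- If (φ , ψ) votes `t` at x and the translated edge is proper, then (ψ , φ) votes `not t` at y,
  -- as φ and ψ have the same sign. `tally-flip` turns the latter votes into ordinary ones.
  votes-edge : ∀ {x y} → m x y ≢ 0 → ∀ t → votes t x * 60 ≤ order + votes (not t) y * 60
  votes-edge {x} {y} xy t = begin
    votes t x * 60                                ≤⟨ *-monoˡ-≤ 60 (tally-mono step) ⟩
    tally (λ φ ψ → improper φ ψ + vote (not t) y ψ φ) * 60
      ≡⟨ cong (_* 60) (tally-+ improper (λ φ ψ → vote (not t) y ψ φ)) ⟩
    (tally improper + tally (λ φ ψ → vote (not t) y ψ φ)) * 60
      ≡⟨ cong (λ k → (tally improper + k) * 60) (tally-flip und (vote (not t) y)) ⟩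
    (tally improper + votes (not t) y) * 60       ≡⟨ *-distribʳ-+ 60 (tally improper) _ ⟩
    tally improper * 60 + votes (not t) y * 60    ≤⟨ +-monoˡ-≤ _ (few-improper xy) ⟩
    order + votes (not t) y * 60                  ∎
    where
    open ≤-Reasoning
    improper : SelfMap n → SelfMap n → ℕ
    improper φ ψ = 𝟙 (not (proper (χ (φ x)) (χ (ψ y))))
    step : ∀ {φ ψ} → TwoFold m φ ψ → vote t x φ ψ ≤ improper φ ψ + vote (not t) y ψ φ
    step {φ} {ψ} s with is (sign φ · t) (χ (φ x)) in eq
    ... | false = z≤n
    ... | true with is-true {sign φ · t} {χ (φ x)} eq
    ...   | eq′ rewrite eq′ | sym (sign-flip s) | ·-not (sign φ) t with is (not (sign φ · t)) (χ (ψ y))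
    ...     | true  = ≤-refl
    ...     | false = ≤-refl

  -- On an edge, `not t` would get more than 9/10 - 1/60 of the votes at y, while `t` already has
  -- more than 9/10 of them.
  same-winner⇒nonadjacent : ∀ {x y} t → order * 9 < votes t x * 10 → order * 9 < votes t y * 10 → m x y ≡ 0
  same-winner⇒nonadjacent {x} {y} t hx hy = decidable-stable (m x y ≟ℕ 0) λ xy →
    contradiction 0<order (≤⇒≯ (lin (12 + order * 46)
      (+-mono-≤ (+-mono-≤ (*-monoˡ-≤ 6 hx) (*-monoˡ-≤ 6 hy)) (+-mono-≤ (votes-edge xy t) (*-monoˡ-≤ 60 (votes-disjoint t y))))
      (id₁ order (votes t x) (votes t y) (votes (not t) y))))
    where
    id₁ : ∀ k a b c → k + ((a * 10) * 6 + (b * 10) * 6 + (k + c * 60 + k * 60)) + (12 + k * 46)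
      ≡ 0 + ((1 + k * 9) * 6 + (1 + k * 9) * 6 + (a * 60 + (b + c) * 60))
    id₁ = solve-∀

  winner : Fin n → Bool
  winner x = does (order * 9 <? votes true x * 10)

  winner-wins : ∀ x → order * 9 < votes (winner x) x * 10
  winner-wins x = does-satisfies (λ t → order * 9 < votes t x * 10) (order * 9 <? votes true x * 10) (landslide x)

  impossible : ⊥
  impossible = nb (winner , λ x y eq →
    same-winner⇒nonadjacent (winner x) (winner-wins x) (subst (λ t → order * 9 < votes t y * 10) (sym eq) (winner-wins y)))

-- Two-fold transitivity of the four families

module _ {n : ℕ} (G : FinGroup n) (S : Subset n) (α : Automorphism G) {m : Graph n} where
  open FinGroup G
  open Automorphism α

  private
    group : Group _ _
    group = record { isGroup = isGroup }

  open Group group using (assoc; identityˡ; identityʳ; inverseˡ; inverseʳ)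
  open GroupProperties group using (∙-cancelˡ; ∙-cancelʳ; ⁻¹-anti-homo-∙)

  private
    shift : ∀ {x x′ y} g → x′ ≡ g ∙ x → ∀ b →
      (if b ∧ does (σ g ∙ y ≟ σ x′) then 1 else 0) ≡ (if b ∧ does (y ≟ σ x) then 1 else 0)
    shift {x} {_} {y} g refl b = cong (λ c → if b ∧ c then 1 else 0) (does-⇔ (mk⇔
      (λ eq → ∙-cancelˡ (σ g) _ _ (trans eq (hom g x)))
      (λ eq → trans (cong (σ g ∙_) eq) (sym (hom g x))))
      (σ g ∙ y ≟ σ (g ∙ x)) (y ≟ σ x))

  -- Left translation by g on one side is matched by σ g on the other, because σ (g x s) = σ g · σ
  -- (x s).
  twistedCayley-transitive : (∀ x y → m x y ≡ twistedCayley G S α x y) → TwoFoldTransitive m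
  twistedCayley-transitive eq u v = (g ∙_) , (σ g ∙_) ,
    twoFold (∙-cancelˡ g _ _) (∙-cancelˡ (σ g) _ _) (λ x y → trans (eq _ _) (trans
      (Σ-cong λ s → shift g (assoc g x s) (lookup S s)) (sym (eq x y)))) ,
    trans (assoc v (u ⁻¹) u) (trans (cong (v ∙_) (inverseˡ u)) (identityʳ v))
    where
    g : Fin n
    g = v ∙ (u ⁻¹)

  -- Inversion turns right translation of x by g into left translation of x⁻¹ s by g⁻¹, which σ
  -- carries to σ (g⁻¹).
  twistedCayleySum-transitive : (∀ x y → m x y ≡ twistedCayleySum G S α x y) → TwoFoldTransitive m
  twistedCayleySum-transitive eq u v = (_∙ g) , (σ (g ⁻¹) ∙_) ,
    twoFold (∙-cancelʳ g _ _) (∙-cancelˡ (σ (g ⁻¹)) _ _) (λ x y → trans (eq _ _) (trans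
      (Σ-cong λ s → shift (g ⁻¹) (trans (cong (_∙ s) (⁻¹-anti-homo-∙ x g)) (assoc (g ⁻¹) (x ⁻¹) s)) (lookup S s))
      (sym (eq x y)))) ,
    trans (sym (assoc u (u ⁻¹) v)) (trans (cong (_∙ v) (inverseʳ u)) (identityˡ v))
    where
    g : Fin n
    g = (u ⁻¹) ∙ v

twoFoldTransitive : ∀ {n} {m : Graph n} →
  IsCayleySumGraph m ⊎ IsTwistedCayleyGraph m ⊎ IsTwistedCayleySumGraph m ⊎ IsVertexTransitive m →
  TwoFoldTransitive m
twoFoldTransitive (inj₁ (G , S , eq))                     = twistedCayleySum-transitive G S (identityAut G) eq
twoFoldTransitive (inj₂ (inj₁ (G , S , α , eq)))          = twistedCayley-transitive G S α eq
twoFoldTransitive (inj₂ (inj₂ (inj₁ (G , S , α , eq))))   = twistedCayleySum-transitive G S α eq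
twoFoldTransitive (inj₂ (inj₂ (inj₂ vt))) u v with vt u v
... | f , (inj , _) , pres , fu≡v = f , f , twoFold inj inj pres , fu≡v

-- Sizes of subsets and rational ratios

∣∣≡# : ∀ {n} (S : Subset n) → ∣ S ∣ ≡ # (lookup S)
∣∣≡# []          = refl
∣∣≡# (true  ∷ S) = cong suc (∣∣≡# S)
∣∣≡# (false ∷ S) = ∣∣≡# S

#-cong : ∀ {n} {p q : Fin n → Bool} → p ≗ q → # p ≡ # q
#-cong e = Σ-cong (cong 𝟙 ∘ e)

∣tabulate∣ : ∀ {n} (p : Fin n → Bool) → ∣ tabulate p ∣ ≡ # p
∣tabulate∣ p = trans (∣∣≡# (tabulate p)) (#-cong (lookup∘tabulate p))

#-witness : ∀ {n} {p : Fin n → Bool} → 0 < # p → ∃ λ x → p x ≡ true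
#-witness {n} {p} h with Σ-< (λ _ → 0) (𝟙 ∘ p) (subst (_< # p) (sym (trans (Σ-const n 0) (*-zeroʳ n))) h)
... | x , lt with p x in eq
...   | true = x , eq

nonempty⇒0<∣∣ : ∀ {n} {S : Subset n} → Nonempty S → 0 < ∣ S ∣
nonempty⇒0<∣∣ {S = S} (x , x∈S) = begin
  1                   ≡⟨ cong 𝟙 (sym ([]=⇒lookup x∈S)) ⟩
  𝟙 (lookup S x)      ≤⟨ term≤Σ (𝟙 ∘ lookup S) x ⟩
  # (lookup S)        ≡⟨ sym (∣∣≡# S) ⟩
  ∣ S ∣               ∎
  where open ≤-Reasoning

tabulate-cheeger : ∀ {n} (p : Fin n → Bool) → 0 < # p → # p * 2 ≤ n → CheegerSet (tabulate p)
tabulate-cheeger {n} p h h′ with #-witness h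
... | x , px = (x , lookup⇒[]= x (tabulate p) (trans (lookup∘tabulate p x) px))
  , subst (_≤ n) (trans (*-comm (# p) 2) (cong (2 *_) (sym (∣tabulate∣ p)))) h′

lookup-∁ : ∀ {n} (S : Subset n) x → lookup (∁ S) x ≡ not (lookup S x)
lookup-∁ S x = lookup-map x not S

lookup-∪ : ∀ {n} (S T : Subset n) x → lookup (S ∪ T) x ≡ lookup S x ∨ lookup T x
lookup-∪ S T x = lookup-zipWith _∨_ x S T

lookup-∩ : ∀ {n} (S T : Subset n) x → lookup (S ∩ T) x ≡ lookup S x ∧ lookup T x
lookup-∩ S T x = lookup-zipWith _∧_ x S T

-- The quotient `+ a / 1` is normalised through a gcd, which does not reduce for a variable a; the
-- explicit fraction does.
ℕ→ℚ≡mkℚ : ∀ a → ℕ→ℚ a ≡ mkℚ (ℤ.+ a) 0 (Coprimality.sym (Coprimality.1-coprimeTo a))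
ℕ→ℚ≡mkℚ a = ℚₚ.fromℚᵘ-toℚᵘ (mkℚ (ℤ.+ a) 0 (Coprimality.sym (Coprimality.1-coprimeTo a)))

ℕ→ℚ-* : ∀ a b → ℕ→ℚ (a * b) ≡ ℕ→ℚ a ℚ.* ℕ→ℚ b
ℕ→ℚ-* a b rewrite ℕ→ℚ≡mkℚ a | ℕ→ℚ≡mkℚ b = cong (λ z → z ℚ./ 1) (ℤₚ.pos-* a b)

ℕ→ℚ-cancel-< : ∀ {a b} → ℕ→ℚ a ℚ.< ℕ→ℚ b → a < b
ℕ→ℚ-cancel-< {a} {b} h rewrite ℕ→ℚ≡mkℚ a | ℕ→ℚ≡mkℚ b with h
... | ℚ.*<* lt = ℤₚ.drop‿+<+ (subst₂ ℤ._<_ (ℤₚ.*-identityʳ (ℤ.+ a)) (ℤₚ.*-identityʳ (ℤ.+ b)) lt)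

ℕ→ℚ-nonNegative : ∀ a → ℚ.NonNegative (ℕ→ℚ a)
ℕ→ℚ-nonNegative a rewrite ℕ→ℚ≡mkℚ a = _

ℕ→ℚ-positive : ∀ {a} → 0 < a → ℚ.Positive (ℕ→ℚ a)
ℕ→ℚ-positive {suc a} _ rewrite ℕ→ℚ≡mkℚ (suc a) = _

-- Cross-multiplies k b / l = k β < h ≤ a / s, the negation of the bound to be proved, at a
-- minimising pair for β and any competitor for h.
clear-denominators : ∀ {h β : ℚ} k {a b s l} → 0 < s → 0 < l →
  h ≤[ a / s ] → β ≡[ b / l ] → ℕ→ℚ k ℚ.* β ℚ.< h → k * b * s < a * l
clear-denominators {h} {β} k {a} {b} {s} {l} 0<s 0<l h≤a/s β≡b/l kβ<h = ℕ→ℚ-cancel-< (begin-strict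
  ℕ→ℚ (k * b * s)                    ≡⟨ trans (ℕ→ℚ-* (k * b) s) (cong (ℚ._* S) (ℕ→ℚ-* k b)) ⟩
  ℕ→ℚ k ℚ.* ℕ→ℚ b ℚ.* S              ≡⟨ cong (λ z → ℕ→ℚ k ℚ.* z ℚ.* S) (sym β≡b/l) ⟩
  ℕ→ℚ k ℚ.* (β ℚ.* L) ℚ.* S          ≡⟨ cong (ℚ._* S) (sym (ℚₚ.*-assoc (ℕ→ℚ k) β L)) ⟩
  ℕ→ℚ k ℚ.* β ℚ.* L ℚ.* S            <⟨ ℚₚ.*-monoˡ-<-pos S {{ℕ→ℚ-positive 0<s}} (ℚₚ.*-monoˡ-<-pos L {{ℕ→ℚ-positive 0<l}} kβ<h) ⟩
  h ℚ.* L ℚ.* S                      ≡⟨ trans (ℚₚ.*-assoc h L S) (trans (cong (h ℚ.*_) (ℚₚ.*-comm L S)) (sym (ℚₚ.*-assoc h S L))) ⟩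
  h ℚ.* S ℚ.* L                      ≤⟨ ℚₚ.*-monoʳ-≤-nonNeg L {{ℕ→ℚ-nonNegative l}} h≤a/s ⟩
  ℕ→ℚ a ℚ.* L                        ≡⟨ sym (ℕ→ℚ-* a l) ⟩
  ℕ→ℚ (a * l)                        ∎)
  where
  open ℚₚ.≤-Reasoning
  S L : ℚ
  S = ℕ→ℚ s
  L = ℕ→ℚ l

-- Pairs (L , R) as partial 2-colourings

colour : Bool → Bool → Maybe Bool
colour true  _     = just true
colour false true  = just false
colour false false = nothing

colour-nothing : ∀ a b → is-nothing (colour a b) ≡ not (a ∨ b)
colour-nothing true  _     = refl
colour-nothing false true  = refl
colour-nothing false false = refl

∧-not-elim : ∀ a b → a ∧ not b ≡ true → a ≡ true × b ≡ false
∧-not-elim true false _ = refl , refl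

not-involutive-≡ : ∀ {a b} → a ≡ not b → not a ≡ b
not-involutive-≡ {b = true}  refl = refl
not-involutive-≡ {b = false} refl = refl

#-complement : ∀ {n} (p : Fin n → Bool) → # p + # (not ∘ p) ≡ n
#-complement {n} p = begin
  # p + # (not ∘ p)                         ≡⟨ Σ-+ (𝟙 ∘ p) (𝟙 ∘ not ∘ p) ⟨
  Σ[ n ] (λ x → 𝟙 (p x) + 𝟙 (not (p x)))    ≡⟨ Σ-cong (λ x → split (p x)) ⟩
  Σ[ n ] (λ _ → 1)                          ≡⟨ trans (Σ-const n 1) (*-identityʳ n) ⟩
  n                                         ∎
  where
  open ≡-Reasoning
  split : ∀ b → 𝟙 b + 𝟙 (not b) ≡ 1
  split true  = refl
  split false = refl

leak : ∀ {a b c} {P : Set} → (a ≡ true → b ≡ true → c ≡ true → P) → ¬ P →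
  1 ≤ 𝟙 (not a) + (𝟙 (not b) + 𝟙 (not c))
leak {false}               h ¬p = s≤s z≤n
leak {true} {false}        h ¬p = s≤s z≤n
leak {true} {true} {false} h ¬p = ≤-refl
leak {true} {true} {true}  h ¬p = contradiction (h refl refl refl) ¬p

module BipartitePair {n : ℕ} (m : Graph n) (L R : Subset n) where

  χ : Fin n → Maybe Bool
  χ x = colour (lookup L x) (lookup R x)

  uncoloured coloured : Fin n → Bool
  uncoloured x = is-nothing (χ x)
  coloured = not ∘ uncoloured

  size : ℕ
  size = ∣ L ∪ R ∣

  lookup-L∪R : ∀ x → lookup (L ∪ R) x ≡ coloured x
  lookup-L∪R x = trans (lookup-∪ L R x) (sym (not-involutive-≡ (colour-nothing (lookup L x) (lookup R x))))

  #coloured : # coloured ≡ size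
  #coloured = trans (sym (#-cong lookup-L∪R)) (sym (∣∣≡# (L ∪ R)))

  size+#uncoloured : size + # uncoloured ≡ n
  size+#uncoloured = trans (cong (_+ # uncoloured) (sym #coloured)) (trans (+-comm (# coloured) (# uncoloured)) (#-complement uncoloured))

  size≤n : size ≤ n
  size≤n = subst (size ≤_) size+#uncoloured (m≤m+n size _)

  uncoloured-small : n < size * 2 → # uncoloured * 2 ≤ n
  uncoloured-small size-large = lin {l = 1 + n} {r = size * 2} 1 size-large
    (subst (λ k → # uncoloured * 2 + size * 2 + 1 ≡ k + (1 + k)) size+#uncoloured (id₁ (# uncoloured) size))
    where
    id₁ : ∀ c s → c * 2 + s * 2 + 1 ≡ s + c + (1 + (s + c))
    id₁ = solve-∀

  improper : Fin n → Fin n → ℕ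
  improper x y = 𝟙 (not (proper (χ x) (χ y)))

  -- The property that `class-invariant` gives to unions of classes: only edges improper for χ or
  -- for one of its two translates can leave p.
  Nonseparating : (φ ψ : SelfMap n) (p : Fin n → Bool) → Set
  Nonseparating φ ψ p = ∀ x y → m x y ≢ 0 → p x ≡ true → proper (χ x) (χ y) ≡ true →
    proper (χ (φ x)) (χ (ψ y)) ≡ true → proper (χ (ψ x)) (χ (φ y)) ≡ true → p y ≡ true

  separated⇒improper : ∀ {φ ψ p} → Nonseparating φ ψ p → ∀ {x y} → m x y ≢ 0 → p x ≡ true → p y ≡ false →
    1 ≤ improper x y + (improper (φ x) (ψ y) + improper (ψ x) (φ y))
  separated⇒improper closed {x} {y} xy px py = leak (closed x y xy px) (λ py′ → true≢false (trans (sym py′) py))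
    where
    true≢false : true ≢ false
    true≢false ()

-- The edge constants

cut : ∀ {n} → Graph n → (Fin n → Bool) → ℕ
cut {n} m p = Σ[ n ] λ x → Σ[ n ] λ y → 𝟙 (p x ∧ not (p y)) * m x y

if≡𝟙* : ∀ b k → (if b then k else 0) ≡ 𝟙 b * k
if≡𝟙* true  k = sym (+-identityʳ k)
if≡𝟙* false k = refl

E≡Σ : ∀ {n} (m : Graph n) A B {p q : Fin n → Bool} → lookup A ≗ p → lookup B ≗ q →
  E m A B ≡ Σ[ n ] λ x → Σ[ n ] λ y → 𝟙 (p x ∧ q y) * m x y
E≡Σ m A B e e′ = Σ-cong λ x → Σ-cong λ y → trans (if≡𝟙* (lookup A x ∧ lookup B y) (m x y))
  (cong₂ (λ a b → 𝟙 (a ∧ b) * m x y) (e x) (e′ y))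

∂edge-tabulate : ∀ {n} (m : Graph n) p → ∂edge m (tabulate p) ≡ cut m p
∂edge-tabulate m p = E≡Σ m (tabulate p) (∁ (tabulate p)) (lookup∘tabulate p)
  (λ x → trans (lookup-∁ (tabulate p) x) (cong not (lookup∘tabulate p x)))

cut-complement : ∀ {n} {m : Graph n} → Undirected m → ∀ p → cut m (not ∘ p) ≡ cut m p
cut-complement {n} {m} und p = trans (Σ-swap λ x y → 𝟙 (not (p x) ∧ not (not (p y))) * m x y)
  (Σ-cong λ y → Σ-cong λ x → cong₂ _*_ (cong 𝟙 (swap (p x) (p y))) (und x y))
  where
  swap : ∀ a b → not a ∧ not (not b) ≡ b ∧ not a
  swap true  true  = refl
  swap true  false = refl
  swap false true  = refl
  swap false false = refl

cut≤degree : ∀ {n} {m : Graph n} {d} → Regular m d → ∀ p → cut m p ≤ d * # p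
cut≤degree reg p = ≤-trans (Σ-mono λ x → Σ-mono λ y → *-monoˡ-≤ _ (𝟙-mono (∧-conicalˡ (p x) (not (p y)))))
  (≤-reflexive (Σ-degreeˡ reg (𝟙 ∘ p)))

module EdgeCase {n : ℕ} (m : Graph n) (d : ℕ)
  (reg : Regular m d) (und : Undirected m) (nb : NonBipartite m) (trs : TwoFoldTransitive m)
  (L R : Subset n) (disjoint : ∀ x → lookup L x ≡ true → lookup R x ≡ true → ⊥)
  (0<size : 0 < ∣ L ∪ R ∣) (nontrivial : ∃ λ (p : Fin n → Bool) → 0 < # p × # p * 2 ≤ n)
  (expands : ∀ p → 0 < # p → # p * 2 ≤ n → βedgeNum m d L R * # p * (d * 90) < cut m p * ∣ L ∪ R ∣)
  where

  open BipartitePair m L R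

  b e : ℕ
  b = βedgeNum m d L R
  e = Σ[ n ] λ x → Σ[ n ] λ y → improper x y * m x y

  0<d : 0 < d
  0<d = nonBipartite⇒0<d reg nb

  e≤b : e ≤ b
  e≤b = begin
    e
      ≤⟨ Σ-mono (λ x → Σ-mono λ y → ≤-trans (*-monoˡ-≤ (m x y) (pointwise x y)) (≤-reflexive (*-distribʳ-+ (m x y) (l x y) (r x y)))) ⟩
    Σ[ n ] (λ x → Σ[ n ] λ y → l x y * m x y + r x y * m x y)
      ≡⟨ Σ-cong (λ x → Σ-+ (λ y → l x y * m x y) (λ y → r x y * m x y)) ⟩
    Σ[ n ] (λ x → Σ[ n ] (λ y → l x y * m x y) + Σ[ n ] (λ y → r x y * m x y))
      ≡⟨ Σ-+ (λ x → Σ[ n ] (λ y → l x y * m x y)) (λ x → Σ[ n ] (λ y → r x y * m x y)) ⟩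
    Σ[ n ] (λ x → Σ[ n ] (λ y → l x y * m x y)) + Σ[ n ] (λ x → Σ[ n ] (λ y → r x y * m x y))
      ≡⟨ sym (cong₂ _+_ (E≡Σ m L (∁ R) (λ _ → refl) (lookup-∁ R)) (E≡Σ m R (∁ L) (λ _ → refl) (lookup-∁ L))) ⟩
    b ∎
    where
    open ≤-Reasoning
    l r : Fin n → Fin n → ℕ
    l x y = 𝟙 (lookup L x ∧ not (lookup R y))
    r x y = 𝟙 (lookup R x ∧ not (lookup L y))
    bound : ∀ a a′ c c′ → (a ≡ true → a′ ≡ true → ⊥) → (c ≡ true → c′ ≡ true → ⊥) →
      𝟙 (not (proper (colour a a′) (colour c c′))) ≤ 𝟙 (a ∧ not c′) + 𝟙 (a′ ∧ not c)
    bound true  true  _     _     h h′ = ⊥-elim (h refl refl)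
    bound _     _     true  true  h h′ = ⊥-elim (h′ refl refl)
    bound true  false true  false h h′ = ≤-refl
    bound true  false false true  h h′ = ≤-refl
    bound true  false false false h h′ = ≤-refl
    bound false true  true  false h h′ = ≤-refl
    bound false true  false true  h h′ = ≤-refl
    bound false true  false false h h′ = ≤-refl
    bound false false true  false h h′ = ≤-refl
    bound false false false true  h h′ = ≤-refl
    bound false false false false h h′ = ≤-refl
    pointwise : ∀ x y → improper x y ≤ l x y + r x y
    pointwise x y = bound (lookup L x) (lookup R x) (lookup L y) (lookup R y) (disjoint x) (disjoint y)

  cut-coloured : cut m coloured ≤ e
  cut-coloured = Σ-mono λ x → Σ-mono λ y → *-monoˡ-≤ (m x y) (leaves (χ x) (χ y))
    where
    leaves : ∀ a c → 𝟙 (not (is-nothing a) ∧ not (not (is-nothing c))) ≤ 𝟙 (not (proper a c))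
    leaves nothing  _        = z≤n
    leaves (just _) (just _) = z≤n
    leaves (just _) nothing  = ≤-refl

  -- Here the d of 90 d is spent: the trivial bound cut ≤ d |p| at one admissible set leaves 90 b <
  -- `size`, so improper edges are few compared with n.
  few-bad : e * 60 ≤ n
  few-bad = few nontrivial
    where
    few : (∃ λ (p : Fin n → Bool) → 0 < # p × # p * 2 ≤ n) → e * 60 ≤ n
    few (p , 0<p , p-small) = begin
      e * 60   ≤⟨ *-mono-≤ e≤b (m≤m+n 60 30) ⟩
      b * 90   ≤⟨ <⇒≤ (*-cancelʳ-< (d * # p) (b * 90) size (begin-strict
        b * 90 * (d * # p)   ≡⟨ id₁ b d (# p) ⟩
        b * # p * (d * 90)   <⟨ expands p 0<p p-small ⟩
        cut m p * size       ≤⟨ *-monoˡ-≤ size (cut≤degree reg p) ⟩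
        d * # p * size       ≡⟨ *-comm (d * # p) size ⟩
        size * (d * # p)     ∎)) ⟩
      size     ≤⟨ size≤n ⟩
      n        ∎
      where
      open ≤-Reasoning
      id₁ : ∀ b d p → b * 90 * (d * p) ≡ b * p * (d * 90)
      id₁ = solve-∀

  -- A cut bounded by a multiple of b makes b cancel and bounds p itself. If b were 0 the strict
  -- inequality would already fail.
  few-from : ∀ p k → cut m p ≤ b * k → # p * 2 ≤ n → 0 < # p → # p * (d * 90) < size * k
  few-from p k cut≤ p-small 0<p = *-cancelʳ-< b (# p * (d * 90)) (size * k) (begin-strict
    # p * (d * 90) * b   ≡⟨ id₁ (# p) d b ⟩
    b * # p * (d * 90)   <⟨ expands p 0<p p-small ⟩
    cut m p * size       ≤⟨ *-monoˡ-≤ size cut≤ ⟩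
    b * k * size         ≡⟨ id₂ b k size ⟩
    size * k * b         ∎)
    where
    open ≤-Reasoning
    id₁ : ∀ p d b → p * (d * 90) * b ≡ b * p * (d * 90)
    id₁ = solve-∀
    id₂ : ∀ b k s → b * k * s ≡ s * k * b
    id₂ = solve-∀

  90≤d*90 : 90 ≤ d * 90
  90≤d*90 = *-monoˡ-≤ 90 0<d

  -- Otherwise L ∪ R would itself be an admissible set; its cut is at most b, and `few-from` would
  -- make it smaller than itself.
  size-large : n < size * 2
  size-large = ≰⇒> λ small → <⇒≱ (few-from coloured 1 (≤-trans cut-coloured (≤-trans e≤b (≤-reflexive (sym (*-identityʳ b)))))
    (subst (λ k → k * 2 ≤ n) (sym #coloured) small) (subst (0 <_) (sym #coloured) 0<size))
    (begin
      size * 1                ≡⟨ cong (_* 1) (sym #coloured) ⟩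
      # coloured * 1          ≤⟨ *-monoʳ-≤ (# coloured) (≤-trans (s≤s z≤n) 90≤d*90) ⟩
      # coloured * (d * 90)   ∎)
    where open ≤-Reasoning

  few-uncoloured : # uncoloured * 45 ≤ n
  few-uncoloured = few (# uncoloured) refl
    where
    open ≤-Reasoning
    cut≤ : cut m uncoloured ≤ b * 1
    cut≤ = begin
      cut m uncoloured   ≡⟨ cut-complement und uncoloured ⟨
      cut m coloured     ≤⟨ cut-coloured ⟩
      e                  ≤⟨ e≤b ⟩
      b                  ≡⟨ *-identityʳ b ⟨
      b * 1              ∎
    few : ∀ c → c ≡ # uncoloured → c * 45 ≤ n
    -- The empty set is not admissible in `expands`.
    few zero    _  = z≤n
    few (suc c) eq = begin
      suc c * 45              ≤⟨ *-mono-≤ (≤-reflexive eq) (≤-trans (m≤m+n 45 45) 90≤d*90) ⟩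
      # uncoloured * (d * 90) ≤⟨ <⇒≤ (few-from uncoloured 1 cut≤ (uncoloured-small size-large) (subst (0 <_) eq (s≤s z≤n))) ⟩
      size * 1                ≡⟨ *-identityʳ size ⟩
      size                    ≤⟨ size≤n ⟩
      n                       ∎

  -- An edge leaving p is improper for χ, or its translate by (φ , ψ) or by (ψ , φ) is. Both
  -- translations permute the ordered pairs of vertices and preserve m, so each of the three kinds
  -- contributes at most e.
  cut-nonseparating : ∀ {φ ψ p} → TwoFold m φ ψ → Nonseparating φ ψ p → cut m p ≤ b * 3
  cut-nonseparating {φ} {ψ} {p} t closed = begin
    cut m p
      ≤⟨ Σ-mono (λ x → Σ-mono λ y → pointwise x y) ⟩
    Σ[ n ] (λ x → Σ[ n ] λ y → F x y + (F (φ x) (ψ y) + F (ψ x) (φ y)))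
      ≡⟨ Σ-cong (λ x → trans (Σ-+ (F x) (λ y → F (φ x) (ψ y) + F (ψ x) (φ y))) (cong (Σ[ n ] (F x) +_) (Σ-+ (λ y → F (φ x) (ψ y)) (λ y → F (ψ x) (φ y))))) ⟩
    Σ[ n ] (λ x → Σ[ n ] (F x) + (Σ[ n ] (λ y → F (φ x) (ψ y)) + Σ[ n ] (λ y → F (ψ x) (φ y))))
      ≡⟨ trans (Σ-+ (λ x → Σ[ n ] (F x)) (λ x → Σ[ n ] (λ y → F (φ x) (ψ y)) + Σ[ n ] (λ y → F (ψ x) (φ y)))) (cong (e +_) (Σ-+ (λ x → Σ[ n ] (λ y → F (φ x) (ψ y))) (λ x → Σ[ n ] (λ y → F (ψ x) (φ y))))) ⟩
    e + (Σ[ n ] (λ x → Σ[ n ] (λ y → F (φ x) (ψ y))) + Σ[ n ] (λ x → Σ[ n ] (λ y → F (ψ x) (φ y))))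
      ≡⟨ cong (e +_) (cong₂ _+_ (moved (TwoFold.injectiveˡ t) (TwoFold.injectiveʳ t)) (moved (TwoFold.injectiveʳ t) (TwoFold.injectiveˡ t))) ⟩
    e + (e + e)
      ≤⟨ +-mono-≤ e≤b (+-mono-≤ e≤b e≤b) ⟩
    b + (b + b)
      ≡⟨ id₁ b ⟩
    b * 3 ∎
    where
    open ≤-Reasoning
    id₁ : ∀ b → b + (b + b) ≡ b * 3
    id₁ = solve-∀
    F : Fin n → Fin n → ℕ
    F x y = improper x y * m x y
    moved : ∀ {f g : SelfMap n} → Injective _≡_ _≡_ f → Injective _≡_ _≡_ g → Σ[ n ] (λ x → Σ[ n ] (λ y → F (f x) (g y))) ≡ e
    moved {f} {g} inj inj′ = trans (Σ-cong λ x → Σ-injection (F (f x)) inj′) (Σ-injection (λ x → Σ[ n ] (F x)) inj)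
    t′ : TwoFold m ψ φ
    t′ = twoFold-flip und t
    scaled : ∀ {i j k} q μ → (μ ≢ 0 → q ≡ true → 1 ≤ i + (j + k)) → 𝟙 q * μ ≤ i * μ + (j * μ + k * μ)
    scaled {i} {j} {k} false μ h = z≤n
    scaled {i} {j} {k} true zero h = z≤n
    scaled {i} {j} {k} true (suc μ) h = ≤-trans (*-monoˡ-≤ (suc μ) (h (λ ()) refl)) (≤-reflexive (id₂ i j k (suc μ)))
      where
      id₂ : ∀ i j k μ → (i + (j + k)) * μ ≡ i * μ + (j * μ + k * μ)
      id₂ = solve-∀
    pointwise : ∀ x y → 𝟙 (p x ∧ not (p y)) * m x y ≤ F x y + (F (φ x) (ψ y) + F (ψ x) (φ y))
    pointwise x y = subst₂ (λ k k′ → 𝟙 (p x ∧ not (p y)) * m x y ≤ F x y + (improper (φ x) (ψ y) * k + improper (ψ x) (φ y) * k′))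
      (sym (TwoFold.preserves t x y)) (sym (TwoFold.preserves t′ x y))
      (scaled {improper x y} {improper (φ x) (ψ y)} {improper (ψ x) (φ y)} (p x ∧ not (p y)) (m x y) λ xy q → separated⇒improper closed xy (proj₁ (∧-not-elim (p x) (p y) q)) (proj₂ (∧-not-elim (p x) (p y) q)))

  no-sparse-cut : ∀ {φ ψ} → TwoFold m φ ψ → ∀ p → Nonseparating φ ψ p → # p * 2 ≤ n → # p * 30 < n
  no-sparse-cut t p closed p-small = few (# p) refl
    where
    open ≤-Reasoning
    few : ∀ k → k ≡ # p → k * 30 < n
    few zero    _  = nonBipartite⇒0<n nb
    few (suc k) eq = <-≤-trans (*-cancelʳ-< 3 (suc k * 30) size (begin-strict
      suc k * 30 * 3   ≡⟨ *-assoc (suc k) 30 3 ⟩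
      suc k * 90       ≤⟨ *-mono-≤ (≤-reflexive eq) 90≤d*90 ⟩
      # p * (d * 90)   <⟨ few-from p 3 (cut-nonseparating t closed) p-small (subst (0 <_) eq (s≤s z≤n)) ⟩
      size * 3         ∎)) size≤n

  impossible : ⊥
  impossible = Averaging.impossible m d reg und nb trs χ (λ x → Σ[ n ] λ y → improper x y * m x y) (λ _ → 0)
    bad (subst (λ k → k * 60 ≤ n) (sym (trans (cong (e +_) (trans (Σ-const n 0) (*-zeroʳ n))) (+-identityʳ e))) few-bad)
    few-uncoloured no-sparse-cut
    where
    open ≤-Reasoning
    bad : ∀ x y → m x y ≢ 0 → proper (χ x) (χ y) ≡ false → 1 ≤ Σ[ n ] (λ y → improper x y * m x y) + 0
    bad x y xy eq = begin
      1                                       ≤⟨ n≢0⇒n>0 xy ⟩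
      m x y                                   ≡⟨ +-identityʳ (m x y) ⟨
      1 * m x y                               ≡⟨ cong (λ c → 𝟙 (not c) * m x y) eq ⟨
      improper x y * m x y                    ≤⟨ term≤Σ (λ y → improper x y * m x y) y ⟩
      Σ[ n ] (λ y → improper x y * m x y)     ≤⟨ m≤m+n _ 0 ⟩
      Σ[ n ] (λ y → improper x y * m x y) + 0 ∎

-- The vertex constants

anyFin-intro : ∀ {n} (p : Fin n → Bool) x → p x ≡ true → anyFin n p ≡ true
anyFin-intro p zero    px rewrite px = refl
anyFin-intro p (suc x) px with p zero
... | true  = refl
... | false = anyFin-intro (p ∘ suc) x px

anyFin-elim : ∀ {n} (p : Fin n → Bool) → anyFin n p ≡ true → ∃ λ x → p x ≡ true
anyFin-elim {suc n} p h with p zero in eq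
... | true  = zero , eq
... | false with anyFin-elim (p ∘ suc) h
...   | x , px = suc x , px

anyFin-cong : ∀ {n} {p q : Fin n → Bool} → p ≗ q → anyFin n p ≡ anyFin n q
anyFin-cong {zero}  e = refl
anyFin-cong {suc n} e = cong₂ _∨_ (e zero) (anyFin-cong (e ∘ suc))

neighbours : ∀ {n} → Graph n → (Fin n → Bool) → Fin n → Bool
neighbours {n} m p y = anyFin n λ x → p x ∧ nonzero? (m x y)

boundary : ∀ {n} → Graph n → (Fin n → Bool) → Fin n → Bool
boundary m p y = neighbours m p y ∧ not (p y)

neighbours-intro : ∀ {n} (m : Graph n) p {x y} → p x ≡ true → m x y ≢ 0 → neighbours m p y ≡ true
neighbours-intro m p {x} {y} px xy = anyFin-intro (λ x → p x ∧ nonzero? (m x y)) x (both (p x) (m x y) px xy)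
  where
  both : ∀ b k → b ≡ true → k ≢ 0 → b ∧ nonzero? k ≡ true
  both true zero    _ k≢0 = contradiction refl k≢0
  both true (suc k) _ _   = refl

neighbours-elim : ∀ {n} (m : Graph n) p {y} → neighbours m p y ≡ true → ∃ λ x → p x ≡ true × m x y ≢ 0
neighbours-elim m p {y} h = unpack (anyFin-elim (λ x → p x ∧ nonzero? (m x y)) h)
  where
  both : ∀ b k → b ∧ nonzero? k ≡ true → b ≡ true × k ≢ 0
  both true (suc k) _ = refl , λ ()
  unpack : (∃ λ x → p x ∧ nonzero? (m x y) ≡ true) → ∃ λ x → p x ≡ true × m x y ≢ 0
  unpack (x , h) = x , both (p x) (m x y) h

boundary-elim : ∀ {n} (m : Graph n) p {y} → boundary m p y ≡ true → (∃ λ x → p x ≡ true × m x y ≢ 0) × p y ≡ false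
boundary-elim m p {y} h = neighbours-elim m p (proj₁ (∧-not-elim (neighbours m p y) (p y) h)) , proj₂ (∧-not-elim (neighbours m p y) (p y) h)

lookup-𝒩 : ∀ {n} (m : Graph n) S {p : Fin n → Bool} → lookup S ≗ p → lookup (𝒩 m S) ≗ neighbours m p
lookup-𝒩 m S e y = trans (lookup∘tabulate _ y) (anyFin-cong λ x → cong (_∧ nonzero? (m x y)) (e x))

lookup-∂vert : ∀ {n} (m : Graph n) S {p : Fin n → Bool} → lookup S ≗ p → lookup (∂vert m S) ≗ boundary m p
lookup-∂vert m S e y = trans (lookup-∩ (𝒩 m S) (∁ S) y)
  (cong₂ _∧_ (lookup-𝒩 m S e y) (trans (lookup-∁ S y) (cong not (e y))))

∣∂vert∣ : ∀ {n} (m : Graph n) S {p : Fin n → Bool} → lookup S ≗ p → ∣ ∂vert m S ∣ ≡ # (boundary m p)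
∣∂vert∣ m S e = trans (∣∣≡# (∂vert m S)) (#-cong (lookup-∂vert m S e))

exists-size : ∀ {n} k → k ≤ n → ∃ λ (p : Fin n → Bool) → # p ≡ k
exists-size {n} zero _ = (λ _ → false) , trans (Σ-const n 0) (*-zeroʳ n)
exists-size (suc k) (s≤s k≤n) with exists-size k k≤n
... | p , eq = (λ { zero → true ; (suc x) → p x }) , cong suc eq

halve : ∀ n → ∃ λ k → k * 2 ≤ n × n ≤ 1 + k * 2
halve zero          = 0 , z≤n , z≤n
halve (suc zero)    = 0 , z≤n , ≤-refl
halve (suc (suc n)) with halve n
... | k , l , u = suc k , s≤s (s≤s l) , s≤s (s≤s u)

module VertexCase {n : ℕ} (m : Graph n) (d : ℕ)
  (reg : Regular m d) (und : Undirected m) (nb : NonBipartite m) (trs : TwoFoldTransitive m)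
  (L R : Subset n)
  (0<size : 0 < ∣ L ∪ R ∣) (2≤n : 2 ≤ n)
  (expands : ∀ p → 0 < # p → # p * 2 ≤ n → βvertNum m d L R * # p * 135 < # (boundary m p) * ∣ L ∪ R ∣)
  where

  open BipartitePair m L R

  b : ℕ
  b = βvertNum m d L R

  B : Fin n → ℕ
  B y = 𝟙 (lookup L y ∧ neighbours m (lookup L) y) + 𝟙 (lookup R y ∧ neighbours m (lookup R) y)
    + 𝟙 (boundary m coloured y)

  ΣB≡b : Σ[ n ] B ≡ b
  ΣB≡b = begin
    Σ[ n ] B
      ≡⟨ Σ-+ (λ y → 𝟙 (lookup L y ∧ neighbours m (lookup L) y) + 𝟙 (lookup R y ∧ neighbours m (lookup R) y)) (𝟙 ∘ boundary m coloured) ⟩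
    Σ[ n ] (λ y → 𝟙 (lookup L y ∧ neighbours m (lookup L) y) + 𝟙 (lookup R y ∧ neighbours m (lookup R) y)) + # (boundary m coloured)
      ≡⟨ cong (_+ # (boundary m coloured)) (Σ-+ (λ y → 𝟙 (lookup L y ∧ neighbours m (lookup L) y)) (λ y → 𝟙 (lookup R y ∧ neighbours m (lookup R) y))) ⟩
    # (λ y → lookup L y ∧ neighbours m (lookup L) y) + # (λ y → lookup R y ∧ neighbours m (lookup R) y) + # (boundary m coloured)
      ≡⟨ cong₂ _+_ (cong₂ _+_ (inner L) (inner R)) (∣∂vert∣ m (L ∪ R) lookup-L∪R) ⟨
    b ∎
    where
    open ≡-Reasoning
    inner : ∀ S → ∣ S ∩ 𝒩 m S ∣ ≡ # (λ y → lookup S y ∧ neighbours m (lookup S) y)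
    inner S = trans (∣∣≡# (S ∩ 𝒩 m S)) (#-cong λ y → trans (lookup-∩ S (𝒩 m S) y) (cong (lookup S y ∧_) (lookup-𝒩 m S (λ _ → refl) y)))

  #boundary-coloured≤b : # (boundary m coloured) ≤ b
  #boundary-coloured≤b = subst (# (boundary m coloured) ≤_) ΣB≡b (Σ-mono {f = 𝟙 ∘ boundary m coloured} {g = B} λ y → m≤n+m _ _)

  -- When x is coloured and the edge is improper, y either has the colour of x, so lies in L ∩ N(L)
  -- or R ∩ N(R), or is an uncoloured neighbour of L ∪ R. Charging y alone makes the total b.
  improper≤B : ∀ {x y} → m x y ≢ 0 → improper x y ≤ B y
  improper≤B {x} {y} xy = bound (lookup L x) (lookup R x) (lookup L y) (lookup R y)
    (neighbours m (lookup L) y) (neighbours m (lookup R) y) (neighbours m coloured y)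
    (λ h → neighbours-intro m (lookup L) {x} {y} h xy)
    (λ h → neighbours-intro m (lookup R) {x} {y} h xy)
    (λ h → neighbours-intro m coloured {x} {y} h xy)
    where
    bound : ∀ a a′ c c′ v v′ w → (a ≡ true → v ≡ true) → (a′ ≡ true → v′ ≡ true) →
      (not (is-nothing (colour a a′)) ≡ true → w ≡ true) →
      𝟙 (not (proper (colour a a′) (colour c c′))) ≤
        𝟙 (c ∧ v) + 𝟙 (c′ ∧ v′) + 𝟙 (w ∧ not (not (is-nothing (colour c c′))))
    bound true  _     true  c′    v v′ w h h′ h″ rewrite h refl = s≤s z≤n
    bound true  _     false true  v v′ w h h′ h″ = z≤n
    bound true  _     false false v v′ w h h′ h″ rewrite h″ refl = ≤-refl
    bound false true  true  c′    v v′ w h h′ h″ = z≤n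
    bound false true  false true  v v′ w h h′ h″ rewrite h′ refl = s≤s z≤n
    bound false true  false false v v′ w h h′ h″ rewrite h″ refl = ≤-refl
    bound false false _     _     v v′ w h h′ h″ = z≤n

  few-from : ∀ p k → # (boundary m p) ≤ b * k → # p * 2 ≤ n → 0 < # p → # p * 135 < size * k
  few-from p k ∂≤ p-small 0<p = *-cancelʳ-< b (# p * 135) (size * k) (begin-strict
    # p * 135 * b             ≡⟨ id₁ (# p) b ⟩
    b * # p * 135             <⟨ expands p 0<p p-small ⟩
    # (boundary m p) * size   ≤⟨ *-monoˡ-≤ size ∂≤ ⟩
    b * k * size              ≡⟨ id₂ b k size ⟩
    size * k * b              ∎)
    where
    open ≤-Reasoning
    id₁ : ∀ p b → p * 135 * b ≡ b * p * 135
    id₁ = solve-∀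
    id₂ : ∀ b k s → b * k * s ≡ s * k * b
    id₂ = solve-∀

  -- Amounts to h ≤ 2: a set of k = ⌊n / 2⌋ ≥ 1 vertices has at most n - k ≤ k + 1 ≤ 2 k vertices
  -- outside it.
  few-bad : b * 135 ≤ n * 2
  few-bad = from-half (halve n)
    where
    open ≤-Reasoning
    disjoint-boundary : ∀ p → # (boundary m p) + # p ≤ n
    disjoint-boundary p = ≤-trans (+-monoˡ-≤ (# p) (#-mono {q = not ∘ p} λ y → ∧-conicalʳ (neighbours m p y) (not (p y))))
      (≤-reflexive (trans (+-comm (# (not ∘ p)) (# p)) (#-complement p)))
    from-set : ∀ k → k * 2 ≤ n → n ≤ 1 + k * 2 → 1 ≤ k → (∃ λ (p : Fin n → Bool) → # p ≡ k) → b * 135 ≤ n * 2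
    from-set k k≤ ≤k 1≤k (p , #p≡k) = ≤-trans
      (<⇒≤ (*-cancelʳ-< k (b * 135) (size * 2) (begin-strict
        b * 135 * k               ≡⟨ id₁ b k ⟩
        b * k * 135               ≡⟨ cong (λ j → b * j * 135) #p≡k ⟨
        b * # p * 135             <⟨ expands p (subst (1 ≤_) (sym #p≡k) 1≤k) (subst (λ j → j * 2 ≤ n) (sym #p≡k) k≤) ⟩
        # (boundary m p) * size   ≤⟨ *-monoˡ-≤ size outside ⟩
        k * 2 * size              ≡⟨ id₂ k size ⟩
        size * 2 * k              ∎)))
      (*-monoˡ-≤ 2 size≤n)
      where
      id₁ : ∀ b k → b * 135 * k ≡ b * k * 135
      id₁ = solve-∀
      id₂ : ∀ k s → k * 2 * s ≡ s * 2 * k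
      id₂ = solve-∀
      id₃ : ∀ o k n → o + (n + (1 + k * 2) + k) + 0 ≡ k * 2 + (o + k + n + 1)
      id₃ = solve-∀
      outside : # (boundary m p) ≤ k * 2
      outside = lin 0 (+-mono-≤ (+-mono-≤ (subst (λ j → # (boundary m p) + j ≤ n) #p≡k (disjoint-boundary p)) ≤k) 1≤k) (id₃ (# (boundary m p)) k n)
    from-half : (∃ λ k → k * 2 ≤ n × n ≤ 1 + k * 2) → b * 135 ≤ n * 2
    from-half (zero  , _  , ≤k) = contradiction (≤-trans 2≤n ≤k) λ { (s≤s ()) }
    from-half (suc k , k≤ , ≤k) = from-set (suc k) k≤ ≤k (s≤s z≤n)
      (exists-size (suc k) (≤-trans (≤-trans (≤-reflexive (sym (*-identityʳ (suc k)))) (*-monoʳ-≤ (suc k) (m≤m+n 1 1))) k≤))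

  size-large : n < size * 2
  size-large = ≰⇒> λ small → <⇒≱
    (few-from coloured 1 (≤-trans #boundary-coloured≤b (≤-reflexive (sym (*-identityʳ b))))
      (subst (λ k → k * 2 ≤ n) (sym #coloured) small) (subst (0 <_) (sym #coloured) 0<size))
    (begin
      size * 1          ≡⟨ cong (_* 1) (sym #coloured) ⟩
      # coloured * 1    ≤⟨ *-monoʳ-≤ (# coloured) (s≤s z≤n) ⟩
      # coloured * 135  ∎)
    where open ≤-Reasoning

  -- The inner boundary of L ∪ R, and with it the boundary of its complement, may
  -- be large; the boundary of remote lies in that of L ∪ R.
  remote : Fin n → Bool
  remote x = uncoloured x ∧ not (neighbours m coloured x)

  -- A neighbour y of a remote vertex is not coloured, since m is symmetric; if y is not remote
  -- either, it must be adjacent to L ∪ R.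
  boundary-remote : ∀ y → boundary m remote y ≡ true → boundary m coloured y ≡ true
  boundary-remote y h = go (boundary-elim m remote h)
    where
    not-remote : ∀ u v → u ∧ not v ≡ false → (u ≡ false → ⊥) → v ∧ not (not u) ≡ true
    not-remote true  true  _ _ = refl
    not-remote false _     _ h = ⊥-elim (h refl)
    is-remote : ∀ u v → u ∧ not v ≡ true → v ≡ true → ⊥
    is-remote true  true () _
    is-remote false _    () _
    go : (∃ λ x → remote x ≡ true × m x y ≢ 0) × remote y ≡ false → boundary m coloured y ≡ true
    go ((x , rx , xy) , ry) = not-remote (uncoloured y) (neighbours m coloured y) ry λ cy →
      is-remote (uncoloured x) (neighbours m coloured x) rx
        (neighbours-intro m coloured {y} {x} (cong not cy) (xy ∘ trans (und x y)))

  #uncoloured≤ : # uncoloured ≤ # remote + b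
  #uncoloured≤ = ≤-trans (Σ-mono λ x → split (uncoloured x) (neighbours m coloured x))
    (≤-trans (≤-reflexive (Σ-+ (𝟙 ∘ remote) (𝟙 ∘ boundary m coloured))) (+-monoʳ-≤ (# remote) #boundary-coloured≤b))
    where
    split : ∀ u v → 𝟙 u ≤ 𝟙 (u ∧ not v) + 𝟙 (v ∧ not (not u))
    split true  true  = ≤-refl
    split true  false = ≤-refl
    split false _     = z≤n

  remote-small : # remote * 2 ≤ n
  remote-small = ≤-trans (*-monoˡ-≤ 2 (#-mono λ x → ∧-conicalˡ (uncoloured x) _)) (uncoloured-small size-large)

  few-remote : # remote * 135 ≤ n
  few-remote = few (# remote) refl
    where
    open ≤-Reasoning
    few : ∀ k → k ≡ # remote → k * 135 ≤ n
    few zero    _  = z≤n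
    few (suc k) eq = begin
      suc k * 135      ≤⟨ *-monoˡ-≤ 135 (≤-reflexive eq) ⟩
      # remote * 135   ≤⟨ <⇒≤ (few-from remote 1 (≤-trans (#-mono boundary-remote) (≤-trans #boundary-coloured≤b (≤-reflexive (sym (*-identityʳ b)))))
                            remote-small (subst (0 <_) eq (s≤s z≤n))) ⟩
      size * 1         ≡⟨ *-identityʳ size ⟩
      size             ≤⟨ size≤n ⟩
      n                ∎

  -- Origin of 135 = 3 · 45: the remote vertices are at most n / 135 and the boundary of L ∪ R at
  -- most 2 n / 135.
  few-uncoloured : # uncoloured * 45 ≤ n
  few-uncoloured = *-cancelʳ-≤ _ _ 3 (lin 0 (+-mono-≤ (+-mono-≤ (*-monoˡ-≤ 135 #uncoloured≤) few-remote) few-bad)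
    (id₁ (# uncoloured) (# remote) b n))
    where
    id₁ : ∀ u r b n → u * 45 * 3 + ((r + b) * 135 + n + n * 2) + 0 ≡ n * 3 + (u * 135 + r * 135 + b * 135)
    id₁ = solve-∀

  -- A boundary vertex y ends an edge leaving p, and the charge falls on y, ψ y or φ y. As φ and ψ
  -- are bijections, each kind totals b.
  boundary-nonseparating : ∀ {φ ψ p} → TwoFold m φ ψ → Nonseparating φ ψ p → # (boundary m p) ≤ b * 3
  boundary-nonseparating {φ} {ψ} {p} t closed = begin
    # (boundary m p)                                       ≤⟨ Σ-mono pointwise ⟩
    Σ[ n ] (λ y → B y + (B (ψ y) + B (φ y)))               ≡⟨ trans (Σ-+ B (λ y → B (ψ y) + B (φ y))) (cong (Σ[ n ] B +_) (Σ-+ (B ∘ ψ) (B ∘ φ))) ⟩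
    Σ[ n ] B + (Σ[ n ] (B ∘ ψ) + Σ[ n ] (B ∘ φ))           ≡⟨ cong (Σ[ n ] B +_) (cong₂ _+_ (Σ-injection B (TwoFold.injectiveʳ t)) (Σ-injection B (TwoFold.injectiveˡ t))) ⟩
    Σ[ n ] B + (Σ[ n ] B + Σ[ n ] B)                       ≡⟨ cong (λ k → k + (k + k)) ΣB≡b ⟩
    b + (b + b)                                            ≡⟨ id₁ b ⟩
    b * 3                                                  ∎
    where
    open ≤-Reasoning
    id₁ : ∀ b → b + (b + b) ≡ b * 3
    id₁ = solve-∀
    t′ : TwoFold m ψ φ
    t′ = twoFold-flip und t
    at : ∀ y → (∃ λ x → p x ≡ true × m x y ≢ 0) × p y ≡ false → 1 ≤ B y + (B (ψ y) + B (φ y))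
    at y ((x , px , xy) , py) = ≤-trans (separated⇒improper closed xy px py)
      (+-mono-≤ (improper≤B xy) (+-mono-≤ (improper≤B (xy ∘ trans (sym (TwoFold.preserves t x y)))) (improper≤B (xy ∘ trans (sym (TwoFold.preserves t′ x y))))))
    pointwise : ∀ y → 𝟙 (boundary m p y) ≤ B y + (B (ψ y) + B (φ y))
    pointwise y = when (boundary m p y) λ h → at y (boundary-elim m p h)
      where
      when : ∀ q {k} → (q ≡ true → 1 ≤ k) → 𝟙 q ≤ k
      when true  h = h refl
      when false h = z≤n

  no-sparse-cut : ∀ {φ ψ} → TwoFold m φ ψ → ∀ p → Nonseparating φ ψ p → # p * 2 ≤ n → # p * 30 < n
  no-sparse-cut t p closed p-small = few (# p) refl
    where
    open ≤-Reasoning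
    few : ∀ k → k ≡ # p → k * 30 < n
    few zero    _  = nonBipartite⇒0<n nb
    few (suc k) eq = <-≤-trans (*-cancelʳ-< 3 (suc k * 30) size (begin-strict
      suc k * 30 * 3   ≡⟨ *-assoc (suc k) 30 3 ⟩
      suc k * 90       ≤⟨ *-mono-≤ (≤-reflexive eq) (m≤m+n 90 45) ⟩
      # p * 135        <⟨ few-from p 3 (boundary-nonseparating t closed) p-small (subst (0 <_) eq (s≤s z≤n)) ⟩
      size * 3         ∎)) size≤n

  impossible : ⊥
  impossible = Averaging.impossible m d reg und nb trs χ (λ _ → 0) B
    (λ x y xy eq → subst (λ c → 𝟙 (not c) ≤ B y) eq (improper≤B xy))
    (subst₂ (λ k l → (k + l) * 60 ≤ n) (sym (trans (Σ-const n 0) (*-zeroʳ n))) (sym ΣB≡b)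
      -- From 135 b ≤ 2 n to 120 b ≤ 2 n, then halved.
      (*-cancelʳ-≤ (b * 60) n 2 (≤-trans (≤-reflexive (*-assoc b 60 2)) (≤-trans (*-monoʳ-≤ b (m≤m+n 120 15)) few-bad))))
    few-uncoloured no-sparse-cut

-- From the minimal ratios to the two bounds

bipPair-disjoint : ∀ {n} {L R : Subset n} → BipPair L R → ∀ x → lookup L x ≡ true → lookup R x ≡ true → ⊥
bipPair-disjoint {L = L} {R} (disjoint , _) x Lx Rx = disjoint x (lookup⇒[]= x L Lx) (lookup⇒[]= x R Rx)

module _ {n : ℕ} {m : Graph n} {d : ℕ} (trs : TwoFoldTransitive m)
  (reg : Regular m d) (und : Undirected m) (nb : NonBipartite m) where

  edge-bound : ∀ (𝔥 β : ℚ) → IsEdgeCheeger m d 𝔥 → IsEdgeBipartiteness m d β → 𝔥 ℚ.≤ (ℤ.+ (90 * d) / 1) *ℚ β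
  edge-bound 𝔥 β ((S , (S≢∅ , S-small) , _) , minimal) ((L , R , pair , β≡) , _) =
    decidable-stable (𝔥 ℚₚ.≤? ℕ→ℚ (90 * d) *ℚ β) λ 𝔥≰ →
      EdgeCase.impossible m d reg und nb trs L R (bipPair-disjoint pair) 0<size
        (lookup S , subst (0 <_) (∣∣≡# S) (nonempty⇒0<∣∣ S≢∅)
          , subst (_≤ n) (trans (*-comm 2 ∣ S ∣) (cong (_* 2) (∣∣≡# S))) S-small)
        (expands (ℚₚ.≰⇒> 𝔥≰))
    where
    size : ℕ
    size = ∣ L ∪ R ∣
    b : ℕ
    b = βedgeNum m d L R
    0<size : 0 < size
    0<size = nonempty⇒0<∣∣ (proj₂ pair)
    0<d : 0 < d
    0<d = nonBipartite⇒0<d reg nb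
    expands : ℕ→ℚ (90 * d) *ℚ β ℚ.< 𝔥 → ∀ p → 0 < # p → # p * 2 ≤ n → b * # p * (d * 90) < cut m p * size
    -- Both denominators carry a d, so cross-multiplication leaves one common factor d to cancel.
    expands β<𝔥 p 0<p p-small = *-cancelʳ-< d (b * # p * (d * 90)) (cut m p * size) (begin-strict
      b * # p * (d * 90) * d        ≡⟨ cong (λ k → b * # p * k * d) (*-comm d 90) ⟩
      b * # p * (90 * d) * d        ≡⟨ id₁ b (# p) (90 * d) d ⟩
      90 * d * b * (d * # p)        ≡⟨ cong (λ k → 90 * d * b * (d * k)) (sym (∣tabulate∣ p)) ⟩
      90 * d * b * (d * ∣ T ∣)      <⟨ clear-denominators {𝔥} {β} (90 * d) {a = ∂edge m T} {b = b}
                                        (*-mono-≤ 0<d (subst (0 <_) (sym (∣tabulate∣ p)) 0<p)) (*-mono-≤ 0<d 0<size)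
                                        (minimal T (tabulate-cheeger p 0<p p-small)) β≡ β<𝔥 ⟩
      ∂edge m T * (d * size)        ≡⟨ cong (_* (d * size)) (∂edge-tabulate m p) ⟩
      cut m p * (d * size)          ≡⟨ id₂ (cut m p) d size ⟩
      cut m p * size * d            ∎)
      where
      open ≤-Reasoning
      T : Subset n
      T = tabulate p
      id₁ : ∀ b p k d → b * p * k * d ≡ k * b * (d * p)
      id₁ = solve-∀
      id₂ : ∀ c d s → c * (d * s) ≡ c * s * d
      id₂ = solve-∀

  vertex-bound : ∀ (h β : ℚ) → IsVertexCheeger m d h → IsVertexBipartiteness m d β → h ℚ.≤ (ℤ.+ 135 / 1) *ℚ β
  vertex-bound h β ((S , (S≢∅ , S-small) , _) , minimal) ((L , R , pair , β≡) , _) =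
    decidable-stable (h ℚₚ.≤? ℕ→ℚ 135 *ℚ β) λ h≰ →
      VertexCase.impossible m d reg und nb trs L R 0<size
        -- A nonempty set of at most n / 2 vertices forces 2 ≤ n.
        (≤-trans (*-monoʳ-≤ 2 (nonempty⇒0<∣∣ S≢∅)) S-small)
        (expands (ℚₚ.≰⇒> h≰))
    where
    size : ℕ
    size = ∣ L ∪ R ∣
    b : ℕ
    b = βvertNum m d L R
    0<size : 0 < size
    0<size = nonempty⇒0<∣∣ (proj₂ pair)
    expands : ℕ→ℚ 135 *ℚ β ℚ.< h → ∀ p → 0 < # p → # p * 2 ≤ n → b * # p * 135 < # (boundary m p) * size
    expands β<h p 0<p p-small = begin-strict
      b * # p * 135                 ≡⟨ trans (*-comm (b * # p) 135) (sym (*-assoc 135 b (# p))) ⟩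
      135 * b * # p                 ≡⟨ cong (135 * b *_) (∣tabulate∣ p) ⟨
      135 * b * ∣ T ∣               <⟨ clear-denominators {h} {β} 135 {a = ∣ ∂vert m T ∣} {b = b}
                                        (subst (0 <_) (sym (∣tabulate∣ p)) 0<p) 0<size
                                        (minimal T (tabulate-cheeger p 0<p p-small)) β≡ β<h ⟩
      ∣ ∂vert m T ∣ * size          ≡⟨ cong (_* size) (∣∂vert∣ m T (lookup∘tabulate p)) ⟩
      # (boundary m p) * size       ∎
      where
      open ≤-Reasoning
      T : Subset n
      T = tabulate p

theorem1p1 : (n : ℕ) (m : Graph n) (d : ℕ) →
    (IsCayleySumGraph m ⊎ IsTwistedCayleyGraph m
    ⊎ IsTwistedCayleySumGraph m ⊎ IsVertexTransitive m) →
    Regular m d → Undirected m → NonBipartite m →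
    (∀ (𝔥 β : ℚ) → IsEdgeCheeger m d 𝔥 → IsEdgeBipartiteness m d β →
    𝔥 ℚ.≤ (ℤ.+ (90 * d) / 1) *ℚ β)
    × (∀ (h β : ℚ) → IsVertexCheeger m d h → IsVertexBipartiteness m d β →
    h ℚ.≤ (ℤ.+ 135 / 1) *ℚ β)
theorem1p1 n m d cayley reg und nb = edge-bound trs reg und nb , vertex-bound trs reg und nb
  where
  trs : TwoFoldTransitive m
  trs = twoFoldTransitive cayley
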